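{- Let $c<\sqrt{2}$ be a positive real number. Then there exists $n_0$ such that for all integers $n\ge n_0$ the following holds: for every $n$-uniform hypergraph $(V,E)$ with at most $c\sqrt{n/\ln(n)}\,2^{n-1}$ edges, the random greedy $2$-coloring algorithm applied to $(V,E)$ produces a proper coloring with positive probability.
   Context: A (finite) hypergraph is a pair $(V,E)$, where $V$ is a finite set of vertices and $E$ is a family (set) of subsets of $V$, called edges. It is $n$-uniform if all its edges have exactly $n$ elements. A coloring $V\to\{1,2\}$ is proper if no edge is monochromatic, i.e. the image of every edge has two elements. Random greedy $2$-coloring algorithm: for each $v\in V$ choose, independently and uniformly at random, a point $t(v)\in[0,1]$ (the birth time of $v$); the function $t$ is assumed injective (this happens with probability 1). Order $V$ as $(v_1,\ldots,v_m)$ by increasing birth time. The last vertex of an edge is its vertex with the largest birth time. For $i=1,\ldots,m$ in turn, color $v_i$ as follows: if there is $j\in\{1,2\}$ such that coloring $v_i$ with $j$ does not create a monochromatic edge whose last vertex is $v_i$, then $v_i$ gets the smallest such $j$; otherwise $v_i$ gets color $2$. Output the resulting coloring. (Equivalently: $v_i$ gets color $1$ unless $v_i$ is the last vertex of an edge all of whose other vertices have color $1$, in which case it gets color $2$.) -}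

module Defs where

open import Data.Empty using (⊥; ⊥-elim)
open import Data.Fin.Base using (Fin)
import Data.Fin.Properties as Fin
open import Data.Fin.Subset using (Subset; _∈_) renaming (∣_∣ to card)
open import Data.Fin.Subset.Properties using (_∈?_)
import Data.Integer.Base as ℤ
import Data.Integer.Properties as ℤ
open import Data.Integer.Solver using () renaming (module +-*-Solver to ℤ-Solver)
open import Data.List.Base as List using (List; allFin; foldl; map)
open import Data.List.Relation.Binary.Permutation.Propositional using (_↭_)
open import Data.List.Relation.Unary.All using (All)
open import Data.List.Relation.Unary.AllPairs using (AllPairs)
open import Data.List.Relation.Unary.Any using (Any; any?)
open import Data.List.Relation.Unary.Unique.Propositional using (Unique)
open import Data.Maybe.Base using (Maybe; just; nothing; fromMaybe)
import Data.Maybe.Properties as Maybe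
open import Data.Nat.Base as ℕ using (ℕ; zero; suc)
import Data.Nat.Properties as ℕ
open import Data.Product using (Σ; ∃; _×_; _,_; proj₁; proj₂)
open import Data.Rational
open import Data.Rational.Properties
open import Data.Rational.Solver using (module +-*-Solver)
import Data.Rational.Unnormalised as ℚᵘ
import Data.Rational.Unnormalised.Properties as ℚᵘ
open import Data.Sum using (_⊎_; inj₁; inj₂; [_,_]′)
import Data.Vec.Functional as Vector
open import Function.Base using (const)
open import Relation.Binary.Definitions using (DecidableEquality)
open import Relation.Binary.PropositionalEquality
open import Relation.Nullary using (¬_; Dec; yes; no)
open import Relation.Nullary.Decidable using (_×-dec_; _→-dec_)

open +-*-Solver using (solve; _:=_; _:+_; _:*_; _:-_; :-_; con)

2ℚ : ℚ
2ℚ = 1ℚ + 1ℚ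

0<1 : 0ℚ < 1ℚ
0<1 = *<* (ℤ.+<+ (ℕ.s≤s ℕ.z≤n))

diff-pos : ∀ {p q} → p < q → 0ℚ < q - p
diff-pos {p} {q} p<q = subst (_< q - p) (+-inverseʳ p) (+-monoˡ-< (- p) p<q)

lt-from-diff : ∀ {p q d} → 0ℚ < d → q ≡ p + d → p < q
lt-from-diff {p} {q} {d} 0<d eq =
  subst (p <_) (sym eq) (subst (_< p + d) (+-identityʳ p) (+-monoʳ-< p 0<d))

p<p+d : ∀ p {d} → 0ℚ < d → p < p + d
p<p+d p {d} 0<d = subst (_< p + d) (+-identityʳ p) (+-monoʳ-< p 0<d)

p≤p+d : ∀ p {d} → 0ℚ ≤ d → p ≤ p + d
p≤p+d p {d} 0≤d = subst (_≤ p + d) (+-identityʳ p) (+-monoʳ-≤ p 0≤d)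

p-1<p : ∀ p → p - 1ℚ < p
p-1<p p = lt-from-diff 0<1 (solve 1 (λ x → x := x :- con 1ℚ :+ con 1ℚ) refl p)

le-from-diff : ∀ {p q d} → 0ℚ ≤ d → q ≡ p + d → p ≤ q
le-from-diff {p} {q} {d} 0≤d eq =
  subst (p ≤_) (sym eq) (subst (_≤ p + d) (+-identityʳ p) (+-monoʳ-≤ p 0≤d))

diff-nonneg : ∀ {p q} → p ≤ q → 0ℚ ≤ q - p
diff-nonneg {p} {q} p≤q = subst (_≤ q - p) (+-inverseʳ p) (+-monoˡ-≤ (- p) p≤q)

add-diff : ∀ p q → q ≡ p + (q - p)
add-diff = solve 2 (λ p q → q := p :+ (q :- p)) refl

*-monoʳ-≤ : ∀ {p q r} → 0ℚ ≤ r → p ≤ q → p * r ≤ q * r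
*-monoʳ-≤ {r = r} 0≤r = *-monoʳ-≤-nonNeg r {{nonNegative 0≤r}}

*-monoˡ-≤ : ∀ {p q r} → 0ℚ ≤ r → p ≤ q → r * p ≤ r * q
*-monoˡ-≤ {r = r} 0≤r = *-monoˡ-≤-nonNeg r {{nonNegative 0≤r}}

*-antiʳ-≤ : ∀ {p q r} → r ≤ 0ℚ → p ≤ q → q * r ≤ p * r
*-antiʳ-≤ {r = r} r≤0 = *-monoʳ-≤-nonPos r {{nonPositive r≤0}}

*-monoʳ-< : ∀ {p q r} → 0ℚ < r → p < q → p * r < q * r
*-monoʳ-< {r = r} 0<r = *-monoˡ-<-pos r {{positive 0<r}}

*-monoˡ-< : ∀ {p q r} → 0ℚ < r → p < q → r * p < r * q
*-monoˡ-< {r = r} 0<r = *-monoʳ-<-pos r {{positive 0<r}}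

*-pos : ∀ {p q} → 0ℚ < p → 0ℚ < q → 0ℚ < p * q
*-pos {p} {q} 0<p 0<q = subst (_< p * q) (*-zeroˡ q) (*-monoʳ-< 0<q 0<p)

*-nonneg : ∀ {p q} → 0ℚ ≤ p → 0ℚ ≤ q → 0ℚ ≤ p * q
*-nonneg {p} {q} 0≤p 0≤q = subst (_≤ p * q) (*-zeroˡ q) (*-monoʳ-≤ 0≤q 0≤p)

+-pos : ∀ {p q} → 0ℚ < p → 0ℚ < q → 0ℚ < p + q
+-pos 0<p 0<q = +-mono-< 0<p 0<q

neg-cancel : ∀ {p q} → - q ≤ - p → p ≤ q
neg-cancel {p} {q} h =
  subst₂ _≤_ (solve 1 (λ p → :- (:- p) := p) refl p) (solve 1 (λ p → :- (:- p) := p) refl q)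
    (neg-antimono-≤ h)

square-nonneg : ∀ p → 0ℚ ≤ p * p
square-nonneg p with ≤-total 0ℚ p
... | inj₁ 0≤p = *-nonneg 0≤p 0≤p
... | inj₂ p≤0 = subst (_≤ p * p) (*-zeroˡ p) (*-antiʳ-≤ p≤0 p≤0)

reciprocal : ∀ p → 0ℚ < p → ∃ λ i → 0ℚ < i × p * i ≡ 1ℚ
reciprocal p 0<p = (1/ p) {{nz}} , positive⁻¹ _ {{1/pos⇒pos p {{pp}}}} , *-inverseʳ p {{nz}}
  where
  pp = positive 0<p
  nz = pos⇒nonZero p {{pp}}

square-< : ∀ {p q} → 0ℚ ≤ p → p < q → p * p < q * q
square-< {p} {q} 0≤p p<q =
  ≤-<-trans (*-monoˡ-≤ 0≤p (<⇒≤ p<q)) (*-monoʳ-< (≤-<-trans 0≤p p<q) p<q)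

toℚᵘ-frac : ∀ n d → toℚᵘ (ℤ.+ n / suc d) ℚᵘ.≃ ℚᵘ.mkℚᵘ (ℤ.+ n) d
toℚᵘ-frac n d = toℚᵘ-fromℚᵘ (ℚᵘ.mkℚᵘ (ℤ.+ n) d)

frac-suc : ∀ n d → ℤ.+ suc n / suc d ≡ ℤ.+ 1 / suc d + ℤ.+ n / suc d
frac-suc n d = toℚᵘ-injective (ℚᵘ.≃-trans (toℚᵘ-frac (suc n) d) (ℚᵘ.≃-sym
  (ℚᵘ.≃-trans (toℚᵘ-homo-+ (ℤ.+ 1 / suc d) (ℤ.+ n / suc d))
    (ℚᵘ.≃-trans (ℚᵘ.+-cong (toℚᵘ-frac 1 d) (toℚᵘ-frac n d)) (ℚᵘ.*≡* eq)))))
  where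
  eq : (ℤ.+ 1 ℤ.* ℤ.+ suc d ℤ.+ ℤ.+ n ℤ.* ℤ.+ suc d) ℤ.* ℤ.+ suc d ≡ ℤ.+ suc n ℤ.* ℤ.+ (suc d ℕ.* suc d)
  eq = trans (ring (ℤ.+ suc d) (ℤ.+ n)) (sym (cong (ℤ.+ suc n ℤ.*_) (ℤ.pos-* (suc d) (suc d))))
    where
    open ℤ-Solver renaming (solve to solveℤ; _:=_ to _:≡_; _:+_ to _:⊕_; _:*_ to _:⊗_; con to conℤ)
    ring : ∀ D N → (ℤ.+ 1 ℤ.* D ℤ.+ N ℤ.* D) ℤ.* D ≡ (ℤ.+ 1 ℤ.+ N) ℤ.* (D ℤ.* D)
    ring = solveℤ 2 (λ D N → (conℤ (ℤ.+ 1) :⊗ D :⊕ N :⊗ D) :⊗ D :≡ (conℤ (ℤ.+ 1) :⊕ N) :⊗ (D :⊗ D)) refl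

frac-mono : ∀ m c n d → m ℕ.* suc d ℕ.≤ n ℕ.* suc c → ℤ.+ m / suc c ≤ ℤ.+ n / suc d
frac-mono m c n d h = toℚᵘ-cancel-≤
  (ℚᵘ.≤-respˡ-≃ (ℚᵘ.≃-sym (toℚᵘ-frac m c)) (ℚᵘ.≤-respʳ-≃ (ℚᵘ.≃-sym (toℚᵘ-frac n d))
    (ℚᵘ.*≤* (subst₂ ℤ._≤_ (ℤ.pos-* m (suc d)) (ℤ.pos-* n (suc c)) (ℤ.+≤+ h)))))

frac-pos : ∀ n d → 0ℚ < ℤ.+ suc n / suc d
frac-pos n d = positive⁻¹ (ℤ.+ suc n / suc d) {{normalize-pos (suc n) (suc d)}}

below-ℕ : ∀ p → ∃ λ N → p ≤ ℤ.+ N / 1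
below-ℕ p@(mkℚ (ℤ.+ n) d _) = n , toℚᵘ-cancel-≤ (ℚᵘ.≤-respʳ-≃ (ℚᵘ.≃-sym (toℚᵘ-frac n 0))
  (ℚᵘ.*≤* (subst₂ ℤ._≤_ (ℤ.pos-* n 1) (ℤ.pos-* n (suc d)) (ℤ.+≤+ (ℕ.*-monoʳ-≤ n (ℕ.s≤s ℕ.z≤n))))))
below-ℕ p@(mkℚ ℤ.-[1+ n ] d _) = 0 , <⇒≤ (negative⁻¹ p)

nat : ℕ → ℚ
nat zero    = 0ℚ
nat (suc n) = 1ℚ + nat n

frac-one : ∀ n → ℤ.+ n / 1 ≡ nat n
frac-one zero    = 0/n≡0 1
frac-one (suc n) = trans (frac-suc n 0) (cong (1ℚ +_) (frac-one n))

below-nat : ∀ p → ∃ λ N → p ≤ nat N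
below-nat p = let N , h = below-ℕ p in N , subst (p ≤_) (frac-one N) h

nat-scale : ∀ M N → ℤ.+ M / suc N ≡ nat M * (ℤ.+ 1 / suc N)
nat-scale zero    N = trans (0/n≡0 (suc N)) (sym (*-zeroˡ (ℤ.+ 1 / suc N)))
nat-scale (suc M) N = trans (frac-suc M N)
  (trans (cong (ℤ.+ 1 / suc N +_) (nat-scale M N)) (lemma (ℤ.+ 1 / suc N) (nat M)))
  where
  lemma : ∀ x m → x + m * x ≡ (1ℚ + m) * x
  lemma = solve 2 (λ x m → x :+ m :* x := (con 1ℚ :+ m) :* x) refl

unit-fraction : ∀ N → nat (suc N) * (ℤ.+ 1 / suc N) ≡ 1ℚ
unit-fraction N = trans (sym (nat-scale (suc N) N)) (toℚᵘ-injective
  (ℚᵘ.≃-trans (toℚᵘ-frac (suc N) N) (ℚᵘ.*≡* (ℤ.*-comm (ℤ.+ suc N) (ℤ.+ 1)))))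

small-unit-fraction : ∀ ε → 0ℚ < ε → ∃ λ j → ℤ.+ 1 / suc j < ε
small-unit-fraction ε 0<ε with reciprocal ε 0<ε
... | i , 0<i , εi≡1 with below-nat i
...   | N , i≤N = N , compare (ℤ.+ 1 / suc N) (nat (suc N)) (frac-pos 0 N) (unit-fraction N)
                        (≤-<-trans i≤N (lt-from-diff 0<1 (+-comm 1ℚ (nat N))))
  where
  lemma : ∀ ε x i → ε * (i * x) ≡ (ε * i) * x
  lemma = solve 3 (λ ε x i → ε :* (i :* x) := (ε :* i) :* x) refl
  compare : ∀ x n → 0ℚ < x → n * x ≡ 1ℚ → i < n → x < ε
  compare x n 0<x nx≡1 i<n = subst₂ _<_
    (trans (lemma ε x i) (trans (cong (_* x) εi≡1) (*-identityˡ x)))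
    (trans (cong (ε *_) nx≡1) (*-identityʳ ε))
    (*-monoˡ-< 0<ε (*-monoʳ-< 0<x i<n))

-- Dedekind cuts: L x q says q < x, and U x q says x < q.

record ℝ : Set₁ where
  field
    L U         : ℚ → Set
    L-inhabited : ∃ λ q → L q
    U-inhabited : ∃ λ q → U q
    L-lower     : ∀ {p q} → p < q → L q → L p
    U-upper     : ∀ {p q} → p < q → U p → U q
    L-open      : ∀ {q} → L q → ∃ λ r → q < r × L r
    U-open      : ∀ {q} → U q → ∃ λ p → p < q × U p
    disjoint    : ∀ {q} → L q → U q → ⊥
    located     : ∀ {p q} → p < q → L p ⊎ U q

open ℝ

infix 4 _<ᴿ_ _≤ᴿ_

_<ᴿ_ : ℝ → ℝ → Set
x <ᴿ y = ∃ λ q → U x q × L y q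

_≤ᴿ_ : ℝ → ℝ → Set
x ≤ᴿ y = ∀ q → L x q → L y q

fromℚ : ℚ → ℝ
fromℚ x = record
  { L           = _< x
  ; U           = x <_
  ; L-inhabited = x - 1ℚ , p-1<p x
  ; U-inhabited = x + 1ℚ , p<p+d x 0<1
  ; L-lower     = <-trans
  ; U-upper     = λ p<q x<p → <-trans x<p p<q
  ; L-open      = <-dense
  ; U-open      = λ x<q → let p , x<p , p<q = <-dense x<q in p , p<q , x<p
  ; disjoint    = λ q<x x<q → <-asym q<x x<q
  ; located     = loc
  }
  where
  loc : ∀ {p q} → p < q → p < x ⊎ x < q
  loc {p} {q} p<q with p <? x
  ... | yes p<x = inj₁ p<x
  ... | no  p≮x = inj₂ (≤-<-trans (≮⇒≥ p≮x) p<q)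

fromℕ : ℕ → ℝ
fromℕ n = fromℚ (ℤ.+ n / 1)

L-≤ : ∀ x {p q} → p ≤ q → L x q → L x p
L-≤ x {p} {q} p≤q l with p <? q
... | yes p<q = L-lower x p<q l
... | no  p≮q = subst (L x) (≤-antisym (≮⇒≥ p≮q) p≤q) l

U-≤ : ∀ x {p q} → p ≤ q → U x p → U x q
U-≤ x {p} {q} p≤q u with p <? q
... | yes p<q = U-upper x p<q u
... | no  p≮q = subst (U x) (≤-antisym p≤q (≮⇒≥ p≮q)) u

L<U : ∀ x {p q} → L x p → U x q → p < q
L<U x {p} {q} l u with p <? q
... | yes p<q = p<q
... | no  p≮q = ⊥-elim (disjoint x l (U-≤ x (≮⇒≥ p≮q) u))

rearrange : ∀ a b i δ → a + (b - a) * i * δ ≡ a + (b - a) * (δ * i)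
rearrange = solve 4 (λ a b i δ → a :+ (b :- a) :* i :* δ := a :+ (b :- a) :* (δ :* i)) refl

collapse : ∀ a b → a + (b - a) * 1ℚ ≡ b
collapse = solve 2 (λ a b → a :+ (b :- a) :* con 1ℚ := b) refl

base : ∀ a δ → a + 0ℚ * δ ≡ a
base = solve 2 (λ a δ → a :+ con 0ℚ :* δ := a) refl

twice : ∀ a δ → a + 2ℚ * δ ≡ a + δ + δ
twice = solve 2 (λ a δ → a :+ con 2ℚ :* δ := a :+ δ :+ δ) refl

step : ∀ a δ n → a + (1ℚ + n) * δ ≡ a + δ + n * δ
step = solve 3 (λ a δ n → a :+ (con 1ℚ :+ n) :* δ := a :+ δ :+ n :* δ) refl

width : ∀ a w → a + w - a ≡ w
width = solve 2 (λ a w → a :+ w :- a := w) refl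

-- Rational enclosures of x of width at most 2δ inside a given one
enclose : ∀ x δ → 0ℚ < δ → ∀ {a₀ b₀} → L x a₀ → U x b₀ →
          ∃ λ a → ∃ λ b → L x a × U x b × a₀ ≤ a × b ≤ b₀ × b - a ≤ 2ℚ * δ
enclose x δ 0<δ {a₀} {b₀} la₀ ub₀ = clip (go (proj₁ steps) la₀ (U-≤ x (proj₂ steps) ub₀))
  where
  steps : ∃ λ N → b₀ ≤ a₀ + nat N * δ
  steps with reciprocal δ 0<δ
  ... | i , 0<i , δi≡1 with below-nat ((b₀ - a₀) * i)
  ...   | N , h = N , subst (_≤ a₀ + nat N * δ) eq (+-monoʳ-≤ a₀ (*-monoʳ-≤ (<⇒≤ 0<δ) h))
    where
    eq : a₀ + (b₀ - a₀) * i * δ ≡ b₀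
    eq = trans (rearrange a₀ b₀ i δ) (trans (cong (λ z → a₀ + (b₀ - a₀) * z) δi≡1) (collapse a₀ b₀))

  go : ∀ N {a} → L x a → U x (a + nat N * δ) →
       ∃ λ a′ → L x a′ × a ≤ a′ × U x (a′ + 2ℚ * δ)
  go zero {a} la u = ⊥-elim (disjoint x la (subst (U x) (base a δ) u))
  go (suc N) {a} la u = [ (λ l → next l (go N l (subst (U x) (step a δ (nat N)) u)))
                        , (λ u′ → a , la , ≤-refl , u′) ]′
                        (located x (lt-from-diff 0<δ (twice a δ)))
    where
    next : L x (a + δ) → (∃ λ a′ → L x a′ × a + δ ≤ a′ × U x (a′ + 2ℚ * δ)) →
           ∃ λ a′ → L x a′ × a ≤ a′ × U x (a′ + 2ℚ * δ)
    next _ (a′ , la′ , a+δ≤a′ , u′) = a′ , la′ , ≤-trans (<⇒≤ (p<p+d a 0<δ)) a+δ≤a′ , u′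

  clip : (∃ λ a′ → L x a′ × a₀ ≤ a′ × U x (a′ + 2ℚ * δ)) →
         ∃ λ a → ∃ λ b → L x a × U x b × a₀ ≤ a × b ≤ b₀ × b - a ≤ 2ℚ * δ
  clip (a , la , a₀≤a , u) = [ (λ h → a , a + 2ℚ * δ , la , u , a₀≤a , h , ≤-reflexive (width a (2ℚ * δ)))
                             , (λ h → a , b₀ , la , ub₀ , a₀≤a , ≤-refl ,
                                      subst (b₀ - a ≤_) (width a (2ℚ * δ)) (+-monoˡ-≤ (- a) h)) ]′
                             (≤-total (a + 2ℚ * δ) b₀)

-- r = q + d/(2q+1+d) with d = s - q²
square-above : ∀ {q s} → 0ℚ ≤ q → q * q < s → ∃ λ r → q < r × r * r ≤ s
square-above {q} {s} 0≤q q²<s = finish (s - q * q) (diff-pos q²<s) (add-diff (q * q) s)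
  where
  finish : ∀ d → 0ℚ < d → s ≡ q * q + d → ∃ λ r → q < r × r * r ≤ s
  finish d 0<d s≡ = close (reciprocal w 0<w)
    where
    w : ℚ
    w = q + q + (1ℚ + d)
    0<1+d : 0ℚ < 1ℚ + d
    0<1+d = +-pos {1ℚ} {d} 0<1 0<d
    0<w : 0ℚ < w
    0<w = +-mono-≤-< {0ℚ} {q + q} (+-mono-≤ 0≤q 0≤q) 0<1+d
    close : (∃ λ i → 0ℚ < i × w * i ≡ 1ℚ) → ∃ λ r → q < r × r * r ≤ s
    close (i , 0<i , wi≡1) = q + d * i , p<p+d q 0<ε ,
      subst (_≤ s) (expand q (d * i)) (subst (q * q + d * i * (q + q + d * i) ≤_) (sym s≡)
        (+-monoʳ-≤ (q * q) (subst (d * i * (q + q + d * i) ≤_) d≡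
          (*-monoˡ-≤ {q + q + d * i} {w} {d * i} (<⇒≤ 0<ε) (+-monoʳ-≤ (q + q) ε≤1+d)))))
      where
      0<ε : 0ℚ < d * i
      0<ε = *-pos {d} {i} 0<d 0<i
      lemma : ∀ d i w → d * i * w ≡ d * (w * i)
      lemma = solve 3 (λ d i w → d :* i :* w := d :* (w :* i)) refl
      d≡ : d * i * w ≡ d
      d≡ = trans (lemma d i w) (trans (cong (d *_) wi≡1) (*-identityʳ d))
      expand : ∀ q e → q * q + e * (q + q + e) ≡ (q + e) * (q + e)
      expand = solve 2 (λ q e → q :* q :+ e :* (q :+ q :+ e) := (q :+ e) :* (q :+ e)) refl
      d≤w : d ≤ w
      d≤w = le-from-diff {d} {w} {q + q + 1ℚ} (+-mono-≤ {0ℚ} {q + q} (+-mono-≤ 0≤q 0≤q) (<⇒≤ 0<1)) (reorder q d)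
        where
        reorder : ∀ q d → q + q + (1ℚ + d) ≡ d + (q + q + 1ℚ)
        reorder = solve 2 (λ q d → q :+ q :+ (con 1ℚ :+ d) := d :+ (q :+ q :+ con 1ℚ)) refl
      ε≤1+d : d * i ≤ 1ℚ + d
      ε≤1+d = ≤-trans (subst (d * i ≤_) wi≡1 (*-monoʳ-≤ {d} {w} {i} (<⇒≤ 0<i) d≤w)) (p≤p+d 1ℚ (<⇒≤ 0<d))

common-< : ∀ {q u v} → u < q → v < q → u ⊔ v < q
common-< {q} {u} {v} u<q v<q with ≤-total u v
... | inj₁ u≤v = subst (_< q) (sym (p≤q⇒p⊔q≡q u≤v)) v<q
... | inj₂ v≤u = subst (_< q) (sym (p≥q⇒p⊔q≡p v≤u)) u<q

-- r = (q² + s⁺)/2q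
square-below : ∀ {q s} → 0ℚ < q → s < q * q → ∃ λ r → 0ℚ < r × r < q × s ≤ r * r
square-below {q} {s} 0<q s<q² = finish (s ⊔ 0ℚ) (p≤q⊔p s 0ℚ) (p≤p⊔q s 0ℚ)
    (common-< s<q² (*-pos {q} {q} 0<q 0<q)) (reciprocal (q + q) (+-pos {q} {q} 0<q 0<q))
  where
  finish : ∀ t → 0ℚ ≤ t → s ≤ t → t < q * q → (∃ λ i → 0ℚ < i × (q + q) * i ≡ 1ℚ) →
           ∃ λ r → 0ℚ < r × r < q × s ≤ r * r
  finish t 0≤t s≤t t<q² (i , 0<i , 2qi≡1) =
    (q * q + t) * i ,
    *-pos {q * q + t} {i} (+-mono-<-≤ {0ℚ} {q * q} (*-pos {q} {q} 0<q 0<q) 0≤t) 0<i ,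
    subst ((q * q + t) * i <_) q≡ (*-monoʳ-< {q * q + t} {q * q + q * q} {i} 0<i (+-monoʳ-< (q * q) t<q²)) ,
    ≤-trans s≤t (le-from-diff {t} {r * r} {h * h} (square-nonneg h) r²≡)
    where
    r h : ℚ
    r = (q * q + t) * i
    h = (q * q - t) * i
    ring₁ : ∀ q i → (q * q + q * q) * i ≡ q * ((q + q) * i)
    ring₁ = solve 2 (λ q i → (q :* q :+ q :* q) :* i := q :* ((q :+ q) :* i)) refl
    q≡ : (q * q + q * q) * i ≡ q
    q≡ = trans (ring₁ q i) (trans (cong (q *_) 2qi≡1) (*-identityʳ q))
    ring₂ : ∀ q t i → ((q * q + t) * i) * ((q * q + t) * i) ≡
      t * (((q + q) * i) * ((q + q) * i)) + ((q * q - t) * i) * ((q * q - t) * i)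
    ring₂ = solve 3 (λ q t i → ((q :* q :+ t) :* i) :* ((q :* q :+ t) :* i) :=
      t :* (((q :+ q) :* i) :* ((q :+ q) :* i)) :+ ((q :* q :- t) :* i) :* ((q :* q :- t) :* i)) refl
    one : ∀ z → z ≡ 1ℚ → t * (z * z) ≡ t
    one z refl = trans (cong (t *_) (*-identityʳ 1ℚ)) (*-identityʳ t)
    r²≡ : r * r ≡ t + h * h
    r²≡ = trans (ring₂ q t i) (cong (_+ h * h) (one ((q + q) * i) 2qi≡1))

quotient-above : ∀ {q u s} → 0ℚ < u → q * u < s → ∃ λ r → q < r × r * u ≤ s
quotient-above {q} {u} {s} 0<u qu<s = finish (reciprocal u 0<u)
  where
  finish : (∃ λ i → 0ℚ < i × u * i ≡ 1ℚ) → ∃ λ r → q < r × r * u ≤ s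
  finish (i , 0<i , ui≡1) = s * i ,
    subst (_< s * i) (trans (*-assoc q u i) (trans (cong (q *_) ui≡1) (*-identityʳ q))) (*-monoʳ-< {q * u} {s} {i} 0<i qu<s) ,
    ≤-reflexive (trans (*-assoc s i u) (trans (cong (s *_) (trans (*-comm i u) ui≡1)) (*-identityʳ s)))

quotient-below : ∀ {q l s} → 0ℚ < l → s < q * l → ∃ λ r → r < q × s ≤ r * l
quotient-below {q} {l} {s} 0<l s<ql = finish (reciprocal l 0<l)
  where
  finish : (∃ λ i → 0ℚ < i × l * i ≡ 1ℚ) → ∃ λ r → r < q × s ≤ r * l
  finish (i , 0<i , li≡1) = s * i ,
    subst (s * i <_) (trans (*-assoc q l i) (trans (cong (q *_) li≡1) (*-identityʳ q))) (*-monoʳ-< {s} {q * l} {i} 0<i s<ql) ,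
    ≤-reflexive (sym (trans (*-assoc s i l) (trans (cong (s *_) (trans (*-comm i l) li≡1)) (*-identityʳ s))))

reciprocal-anti : ∀ {q r i j} → 0ℚ < q → q < r → 0ℚ < i → 0ℚ < j → q * i ≡ 1ℚ → r * j ≡ 1ℚ → j < i
reciprocal-anti {q} {r} {i} {j} 0<q q<r 0<i 0<j qi≡1 rj≡1 =
  subst₂ _<_ eqⱼ eqᵢ (*-monoʳ-< {q} {r} {i * j} (*-pos {i} {j} 0<i 0<j) q<r)
  where
  eqⱼ : q * (i * j) ≡ j
  eqⱼ = trans (sym (*-assoc q i j)) (trans (cong (_* j) qi≡1) (*-identityˡ j))
  eqᵢ : r * (i * j) ≡ i
  eqᵢ = trans (cong (r *_) (*-comm i j)) (trans (sym (*-assoc r j i)) (trans (cong (_* i) rj≡1) (*-identityˡ i)))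

-- Multiplication: q lies below (above) x·y iff it lies below (above) the product of some rational
-- intervals (a,b) ∋ x and (c,d) ∋ y.

record Enclosure (x y : ℝ) : Set where
  field
    a b c d : ℚ
    a<x : L x a
    x<b : U x b
    c<y : L y c
    y<d : U y d

  Corners : (ℚ → Set) → Set
  Corners P = P (a * c) × P (a * d) × P (b * c) × P (b * d)

open Enclosure using (Corners)

edge-> : ∀ {q a b p s} → a ≤ p → p ≤ b → q < a * s → q < b * s → q < p * s
edge-> {s = s} a≤p p≤b h₁ h₂ with ≤-total 0ℚ s
... | inj₁ 0≤s = <-≤-trans h₁ (*-monoʳ-≤ 0≤s a≤p)
... | inj₂ s≤0 = <-≤-trans h₂ (*-antiʳ-≤ s≤0 p≤b)

edge-< : ∀ {q a b p s} → a ≤ p → p ≤ b → a * s < q → b * s < q → p * s < q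
edge-< {s = s} a≤p p≤b h₁ h₂ with ≤-total 0ℚ s
... | inj₁ 0≤s = ≤-<-trans (*-monoʳ-≤ 0≤s p≤b) h₂
... | inj₂ s≤0 = ≤-<-trans (*-antiʳ-≤ s≤0 a≤p) h₁

module _ {x y : ℝ} (R : Enclosure x y) where
  open Enclosure R hiding (Corners)

  Inside : ℚ → ℚ → Set
  Inside p s = a ≤ p × p ≤ b × c ≤ s × s ≤ d

  inside-> : ∀ {q p s} → Inside p s → Corners R (q <_) → q < p * s
  inside-> {q} {p} {s} (a≤p , p≤b , c≤s , s≤d) (ac , ad , bc , bd) = edge-> a≤p p≤b
    (subst (q <_) (*-comm s a) (edge-> c≤s s≤d (subst (q <_) (*-comm a c) ac) (subst (q <_) (*-comm a d) ad)))
    (subst (q <_) (*-comm s b) (edge-> c≤s s≤d (subst (q <_) (*-comm b c) bc) (subst (q <_) (*-comm b d) bd)))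

  inside-< : ∀ {q p s} → Inside p s → Corners R (_< q) → p * s < q
  inside-< {q} {p} {s} (a≤p , p≤b , c≤s , s≤d) (ac , ad , bc , bd) = edge-< a≤p p≤b
    (subst (_< q) (*-comm s a) (edge-< c≤s s≤d (subst (_< q) (*-comm a c) ac) (subst (_< q) (*-comm a d) ad)))
    (subst (_< q) (*-comm s b) (edge-< c≤s s≤d (subst (_< q) (*-comm b c) bc) (subst (_< q) (*-comm b d) bd)))

common-> : ∀ {q u v} → q < u → q < v → q < u ⊓ v
common-> {q} {u} {v} q<u q<v with ≤-total u v
... | inj₁ u≤v = subst (q <_) (sym (p≤q⇒p⊓q≡p u≤v)) q<u
... | inj₂ v≤u = subst (q <_) (sym (p≥q⇒p⊓q≡q v≤u)) q<v

min⁴-< : ∀ {r} u v w z → r < (u ⊓ v) ⊓ (w ⊓ z) → r < u × r < v × r < w × r < z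
min⁴-< u v w z h = <-≤-trans h₁ (p⊓q≤p u v) , <-≤-trans h₁ (p⊓q≤q u v)
                 , <-≤-trans h₂ (p⊓q≤p w z) , <-≤-trans h₂ (p⊓q≤q w z)
  where
  h₁ = <-≤-trans h (p⊓q≤p (u ⊓ v) (w ⊓ z))
  h₂ = <-≤-trans h (p⊓q≤q (u ⊓ v) (w ⊓ z))

max⁴-< : ∀ {r} u v w z → (u ⊔ v) ⊔ (w ⊔ z) < r → u < r × v < r × w < r × z < r
max⁴-< u v w z h = ≤-<-trans (p≤p⊔q u v) h₁ , ≤-<-trans (p≤q⊔p u v) h₁
                 , ≤-<-trans (p≤p⊔q w z) h₂ , ≤-<-trans (p≤q⊔p w z) h₂
  where
  h₁ = ≤-<-trans (p≤p⊔q (u ⊔ v) (w ⊔ z)) h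
  h₂ = ≤-<-trans (p≤q⊔p (u ⊔ v) (w ⊔ z)) h

∣∣-upper : ∀ p → p ≤ ∣ p ∣
∣∣-upper p with ≤-total 0ℚ p
... | inj₁ 0≤p = ≤-reflexive (sym (0≤p⇒∣p∣≡p 0≤p))
... | inj₂ p≤0 = ≤-trans p≤0 (0≤∣p∣ p)

∣∣-lower : ∀ p → - p ≤ ∣ p ∣
∣∣-lower p = subst (- p ≤_) (∣-p∣≡∣p∣ p) (∣∣-upper (- p))

error-bound : ∀ {p w K δ} → p ≤ K → - p ≤ K → 0ℚ ≤ w → w ≤ δ → 0ℚ ≤ K →
              p * w ≤ K * δ × - (K * δ) ≤ p * w
error-bound {p} {w} {K} {δ} p≤K -p≤K 0≤w w≤δ 0≤K =
  ≤-trans (*-monoʳ-≤ 0≤w p≤K) Kw ,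
  neg-cancel (subst₂ _≤_ (sym (neg-distribˡ-* p w)) (sym (solve 1 (λ p → :- (:- p) := p) refl (K * δ)))
    (≤-trans (*-monoʳ-≤ 0≤w -p≤K) Kw))
  where Kw = *-monoˡ-≤ 0≤K w≤δ

0<2 : 0ℚ < 2ℚ
0<2 = +-pos {1ℚ} {1ℚ} 0<1 0<1

-- δ = ε / 10K
choose-δ : ∀ K ε → 0ℚ < K → 0ℚ < ε →
           ∃ λ δ → ∃ λ e → 0ℚ < δ × 0ℚ < e × K * (2ℚ * δ) ≡ e × ε ≡ e + e + e + (e + e)
choose-δ K ε 0<K 0<ε = finish (reciprocal (10ℚ * K) (*-pos {10ℚ} {K} 0<10 0<K))
  where
  10ℚ : ℚ
  10ℚ = nat 10
  0<10 : 0ℚ < 10ℚ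
  0<10 = *<* (ℤ.+<+ (ℕ.s≤s ℕ.z≤n))
  lemma : ∀ K ε i → ε * (10ℚ * K * i) ≡
    K * (2ℚ * (ε * i)) + K * (2ℚ * (ε * i)) + K * (2ℚ * (ε * i)) + (K * (2ℚ * (ε * i)) + K * (2ℚ * (ε * i)))
  lemma = solve 3 (λ K ε i → let e = K :* (con 2ℚ :* (ε :* i)) in
    ε :* (con 10ℚ :* K :* i) := e :+ e :+ e :+ (e :+ e)) refl
  finish : (∃ λ i → 0ℚ < i × 10ℚ * K * i ≡ 1ℚ) →
           ∃ λ δ → ∃ λ e → 0ℚ < δ × 0ℚ < e × K * (2ℚ * δ) ≡ e × ε ≡ e + e + e + (e + e)
  finish (i , 0<i , Ki≡1) = ε * i , K * (2ℚ * (ε * i)) , 0<δ ,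
    *-pos {K} {2ℚ * (ε * i)} 0<K (*-pos {2ℚ} {ε * i} 0<2 0<δ) , refl ,
    trans (sym (*-identityʳ ε)) (trans (cong (ε *_) (sym Ki≡1)) (lemma K ε i))
    where
    0<δ : 0ℚ < ε * i
    0<δ = *-pos {ε} {i} 0<ε 0<i

Near : ℚ → ℚ → ℚ → Set
Near A e v = v ≤ A + (e + e) × A - (e + e) ≤ v

near₀ : ∀ {A e} → 0ℚ < e → Near A e A
near₀ {A} {e} 0<e = p≤p+d A 0≤2e , le-from-diff {A - (e + e)} {A} {e + e} 0≤2e (lemma A e)
  where
  0≤2e : 0ℚ ≤ e + e
  0≤2e = <⇒≤ (+-pos {e} {e} 0<e 0<e)
  lemma : ∀ A e → A ≡ A - (e + e) + (e + e)
  lemma = solve 2 (λ A e → A := A :- (e :+ e) :+ (e :+ e)) refl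

near₂ : ∀ {A e v} w → v ≡ A + w → w ≤ e + e → - (e + e) ≤ w → Near A e v
near₂ {A} {e} w v≡A+w w≤2e -2e≤w =
  subst (_≤ A + (e + e)) (sym v≡A+w) (+-monoʳ-≤ A w≤2e) ,
  subst (A - (e + e) ≤_) (sym v≡A+w) (+-monoʳ-≤ A -2e≤w)

near₁ : ∀ {A e v} w → 0ℚ < e → v ≡ A + w → w ≤ e → - e ≤ w → Near A e v
near₁ {A} {e} w 0<e v≡A+w w≤e -e≤w = near₂ {A} {e} w v≡A+w
  (≤-trans w≤e (p≤p+d e (<⇒≤ 0<e)))
  (≤-trans (le-from-diff { - (e + e)} { - e} {e} (<⇒≤ 0<e) (lemma e)) -e≤w)
  where
  lemma : ∀ e → - e ≡ - (e + e) + e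
  lemma = solve 1 (λ e → :- e := :- (e :+ e) :+ e) refl

Bounded : ℚ → ℚ → Set
Bounded K p = p ≤ K × - p ≤ K

corners-near : ∀ K e δ a b c d → 0ℚ < K → 0ℚ < e → K * δ ≡ e →
  Bounded K a → Bounded K b → Bounded K c →
  a ≤ b → c ≤ d → b - a ≤ δ → d - c ≤ δ →
  Near (a * c) e (a * d) × Near (a * c) e (b * c) × Near (a * c) e (b * d)
corners-near K e δ a b c d 0<K 0<e refl ba bb bc a≤b c≤d wx wy =
  near₁ {a * c} {K * δ} (a * (d - c)) 0<e (eq₁ a c d) (proj₁ Ead) (proj₂ Ead) ,
  near₁ {a * c} {K * δ} (c * (b - a)) 0<e (eq₂ a b c) (proj₁ Ebc) (proj₂ Ebc) ,
  near₂ {a * c} {K * δ} (c * (b - a) + b * (d - c)) (eq₃ a b c d) (+-mono-≤ (proj₁ Ebc) (proj₁ Ebd))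
    (subst (_≤ c * (b - a) + b * (d - c)) (sym (neg-distrib-+ (K * δ) (K * δ))) (+-mono-≤ (proj₂ Ebc) (proj₂ Ebd)))
  where
  err : ∀ {p w} → Bounded K p → 0ℚ ≤ w → w ≤ δ → p * w ≤ K * δ × - (K * δ) ≤ p * w
  err {p} {w} (h₁ , h₂) 0≤w w≤δ = error-bound {p} {w} {K} {δ} h₁ h₂ 0≤w w≤δ (<⇒≤ 0<K)
  Ead = err {a} {d - c} ba (diff-nonneg c≤d) wy
  Ebc = err {c} {b - a} bc (diff-nonneg a≤b) wx
  Ebd = err {b} {d - c} bb (diff-nonneg c≤d) wy
  eq₁ : ∀ a c d → a * d ≡ a * c + a * (d - c)
  eq₁ = solve 3 (λ a c d → a :* d := a :* c :+ a :* (d :- c)) refl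
  eq₂ : ∀ a b c → b * c ≡ a * c + c * (b - a)
  eq₂ = solve 3 (λ a b c → b :* c := a :* c :+ c :* (b :- a)) refl
  eq₃ : ∀ a b c d → b * d ≡ a * c + (c * (b - a) + b * (d - c))
  eq₃ = solve 4 (λ a b c d → b :* d := a :* c :+ (c :* (b :- a) :+ b :* (d :- c))) refl

near-below : ∀ {q r e A v} → r ≡ q + (e + e + e + (e + e)) → A < q + (e + e + e) → Near A e v → v < r
near-below {q} {r} {e} {A} {v} r≡ A<m (h , _) =
  ≤-<-trans h (subst (A + (e + e) <_) (trans (+-assoc q (e + e + e) (e + e)) (sym r≡)) (+-monoˡ-< (e + e) A<m))

near-above : ∀ {q e A v} → 0ℚ < e → q + (e + e + e) ≤ A → Near A e v → q < v
near-above {q} {e} {A} {v} 0<e m≤A (_ , h) = <-≤-trans (p<p+d q 0<e)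
  (≤-trans (subst (_≤ A - (e + e)) (lemma q e) (+-monoˡ-≤ (- (e + e)) m≤A)) h)
  where
  lemma : ∀ q e → q + (e + e + e) - (e + e) ≡ q + e
  lemma = solve 2 (λ q e → q :+ (e :+ e :+ e) :- (e :+ e) := q :+ e) refl

bounded : ∀ {K l u p} → ∣ l ∣ ≤ K → ∣ u ∣ ≤ K → l ≤ p → p ≤ u → Bounded K p
bounded {K} {l} {u} {p} l≤K u≤K l≤p p≤u =
  ≤-trans p≤u (≤-trans (∣∣-upper u) u≤K) ,
  ≤-trans (neg-antimono-≤ l≤p) (≤-trans (∣∣-lower l) l≤K)

common-bound : ∀ a b c d → ∃ λ K → 0ℚ < K × ∣ a ∣ ≤ K × ∣ b ∣ ≤ K × ∣ c ∣ ≤ K × ∣ d ∣ ≤ K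
common-bound a b c d = M + 1ℚ ,
  ≤-<-trans (≤-trans (0≤∣p∣ a) a≤M) (p<p+d M 0<1) , up a≤M ,
  up (≤-trans (p≤q⊔p (∣ a ∣) (∣ b ∣)) (p≤p⊔q (∣ a ∣ ⊔ ∣ b ∣) (∣ c ∣ ⊔ ∣ d ∣))) ,
  up (≤-trans (p≤p⊔q (∣ c ∣) (∣ d ∣)) (p≤q⊔p (∣ a ∣ ⊔ ∣ b ∣) (∣ c ∣ ⊔ ∣ d ∣))) ,
  up (≤-trans (p≤q⊔p (∣ c ∣) (∣ d ∣)) (p≤q⊔p (∣ a ∣ ⊔ ∣ b ∣) (∣ c ∣ ⊔ ∣ d ∣)))
  where
  M : ℚ
  M = (∣ a ∣ ⊔ ∣ b ∣) ⊔ (∣ c ∣ ⊔ ∣ d ∣)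
  a≤M : ∣ a ∣ ≤ M
  a≤M = ≤-trans (p≤p⊔q (∣ a ∣) (∣ b ∣)) (p≤p⊔q (∣ a ∣ ⊔ ∣ b ∣) (∣ c ∣ ⊔ ∣ d ∣))
  up : ∀ {p} → p ≤ M → p ≤ M + 1ℚ
  up p≤M = ≤-trans p≤M (p≤p+d M (<⇒≤ 0<1))

product-located : ∀ x y → Enclosure x y → ∀ {q r} → q < r →
  (Σ (Enclosure x y) λ R → Corners R (q <_)) ⊎ (Σ (Enclosure x y) λ R → Corners R (_< r))
product-located x y R₀ {q} {r} q<r = refine (common-bound R₀.a R₀.b R₀.c R₀.d)
  where
  module R₀ = Enclosure R₀
  Goal : Set
  Goal = (Σ (Enclosure x y) λ R → Corners R (q <_)) ⊎ (Σ (Enclosure x y) λ R → Corners R (_< r))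

  decide : (R : Enclosure x y) → let open Enclosure R hiding (Corners) in
    ∀ e → 0ℚ < e → r ≡ q + (e + e + e + (e + e)) →
    Near (a * c) e (a * d) × Near (a * c) e (b * c) × Near (a * c) e (b * d) →
    Dec (a * c < q + (e + e + e)) → Goal
  decide R e 0<e r≡ (h₁ , h₂ , h₃) (yes A<m) =
    inj₂ (R , below (near₀ {A} {e} 0<e) , below h₁ , below h₂ , below h₃)
    where
    open Enclosure R hiding (Corners)
    A : ℚ
    A = a * c
    below : ∀ {v} → Near A e v → v < r
    below = near-below {q} {r} {e} {A} r≡ A<m
  decide R e 0<e r≡ (h₁ , h₂ , h₃) (no A≮m) =
    inj₁ (R , above (near₀ {A} {e} 0<e) , above h₁ , above h₂ , above h₃)
    where
    open Enclosure R hiding (Corners)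
    A : ℚ
    A = a * c
    above : ∀ {v} → Near A e v → q < v
    above = near-above {q} {e} {A} 0<e (≮⇒≥ A≮m)

  module _ (K : ℚ) (0<K : 0ℚ < K)
    (a≤K : ∣ R₀.a ∣ ≤ K) (b≤K : ∣ R₀.b ∣ ≤ K) (c≤K : ∣ R₀.c ∣ ≤ K) (d≤K : ∣ R₀.d ∣ ≤ K)
    (δ e : ℚ) (0<δ : 0ℚ < δ) (0<e : 0ℚ < e) (Kδ : K * (2ℚ * δ) ≡ e) (r≡ : r ≡ q + (e + e + e + (e + e)))
    where
    build : (∃ λ a → ∃ λ b → L x a × U x b × R₀.a ≤ a × b ≤ R₀.b × b - a ≤ 2ℚ * δ) →
            (∃ λ c → ∃ λ d → L y c × U y d × R₀.c ≤ c × d ≤ R₀.d × d - c ≤ 2ℚ * δ) → Goal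
    build (a , b , la , ub , a₀≤a , b≤b₀ , wx) (c , d , lc , ud , c₀≤c , d≤d₀ , wy) =
      decide (record { a = a ; b = b ; c = c ; d = d ; a<x = la ; x<b = ub ; c<y = lc ; y<d = ud })
        e 0<e r≡
        (corners-near K e (2ℚ * δ) a b c d 0<K 0<e Kδ
          (bounded {K} {R₀.a} {R₀.b} {a} a≤K b≤K a₀≤a (≤-trans a≤b b≤b₀))
          (bounded {K} {R₀.a} {R₀.b} {b} a≤K b≤K (≤-trans a₀≤a a≤b) b≤b₀)
          (bounded {K} {R₀.c} {R₀.d} {c} c≤K d≤K c₀≤c (≤-trans c≤d d≤d₀)) a≤b c≤d wx wy)
        (a * c <? q + (e + e + e))
      where
      a≤b = <⇒≤ (L<U x la ub)
      c≤d = <⇒≤ (L<U y lc ud)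

  refine : (∃ λ K → 0ℚ < K × ∣ R₀.a ∣ ≤ K × ∣ R₀.b ∣ ≤ K × ∣ R₀.c ∣ ≤ K × ∣ R₀.d ∣ ≤ K) → Goal
  refine (K , 0<K , a≤K , b≤K , c≤K , d≤K) = go (choose-δ K (r - q) 0<K (diff-pos q<r))
    where
    go : (∃ λ δ → ∃ λ e → 0ℚ < δ × 0ℚ < e × K * (2ℚ * δ) ≡ e × r - q ≡ e + e + e + (e + e)) → Goal
    go (δ , e , 0<δ , 0<e , Kδ , ε≡) =
      build K 0<K a≤K b≤K c≤K d≤K δ e 0<δ 0<e Kδ (trans (add-diff q r) (cong (q +_) ε≡))
        (enclose x δ 0<δ R₀.a<x R₀.x<b) (enclose y δ 0<δ R₀.c<y R₀.y<d)

infixl 7 _*ᴿ_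

_*ᴿ_ : ℝ → ℝ → ℝ
x *ᴿ y = record
  { L           = Lₓ
  ; U           = Uₓ
  ; L-inhabited = let m = (ac ⊓ ad) ⊓ (bc ⊓ bd) in
      m - 1ℚ , R₀ , min⁴-< ac ad bc bd (p-1<p m)
  ; U-inhabited = let m = (ac ⊔ ad) ⊔ (bc ⊔ bd) in
      m + 1ℚ , R₀ , max⁴-< ac ad bc bd (p<p+d m 0<1)
  ; L-lower     = λ p<q (R , h₁ , h₂ , h₃ , h₄) → R , <-trans p<q h₁ , <-trans p<q h₂ , <-trans p<q h₃ , <-trans p<q h₄
  ; U-upper     = λ p<q (R , h₁ , h₂ , h₃ , h₄) → R , <-trans h₁ p<q , <-trans h₂ p<q , <-trans h₃ p<q , <-trans h₄ p<q
  ; L-open      = λ (R , h₁ , h₂ , h₃ , h₄) →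
      let r , q<r , r<m = <-dense (common-> (common-> h₁ h₂) (common-> h₃ h₄))
      in r , q<r , R , min⁴-< _ _ _ _ r<m
  ; U-open      = λ (R , h₁ , h₂ , h₃ , h₄) →
      let r , m<r , r<q = <-dense (common-< (common-< h₁ h₂) (common-< h₃ h₄))
      in r , r<q , R , max⁴-< _ _ _ _ m<r
  ; disjoint    = dis
  ; located     = product-located x y R₀
  }
  where
  Lₓ Uₓ : ℚ → Set
  Lₓ q = Σ (Enclosure x y) λ R → Corners R (q <_)
  Uₓ q = Σ (Enclosure x y) λ R → Corners R (_< q)

  R₀ : Enclosure x y
  R₀ = record { a<x = proj₂ (L-inhabited x) ; x<b = proj₂ (U-inhabited x)
              ; c<y = proj₂ (L-inhabited y) ; y<d = proj₂ (U-inhabited y) }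
  module R₀ = Enclosure R₀
  ac = R₀.a * R₀.c
  ad = R₀.a * R₀.d
  bc = R₀.b * R₀.c
  bd = R₀.b * R₀.d

  dis : ∀ {q} → Lₓ q → Uₓ q → ⊥
  dis (R , h) (R′ , h′) = <-asym (inside-> R in₁ h) (inside-< R′ in₂ h′)
    where
    module R = Enclosure R
    module R′ = Enclosure R′
    p = R.a ⊔ R′.a
    s = R.c ⊔ R′.c
    in₁ : Inside R p s
    in₁ = p≤p⊔q R.a R′.a , <⇒≤ (common-< (L<U x R.a<x R.x<b) (L<U x R′.a<x R.x<b))
        , p≤p⊔q R.c R′.c , <⇒≤ (common-< (L<U y R.c<y R.y<d) (L<U y R′.c<y R.y<d))
    in₂ : Inside R′ p s
    in₂ = p≤q⊔p R.a R′.a , <⇒≤ (common-< (L<U x R.a<x R′.x<b) (L<U x R′.a<x R′.x<b))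
        , p≤q⊔p R.c R′.c , <⇒≤ (common-< (L<U y R.c<y R′.y<d) (L<U y R′.c<y R′.y<d))

-- The square root; the junk value at negative arguments is 0.
infix 8 √_

√_ : ℝ → ℝ
√ x = record
  { L           = Lₓ
  ; U           = Uₓ
  ; L-inhabited = 0ℚ - 1ℚ , inj₁ (p-1<p 0ℚ)
  ; U-inhabited = U-inh (U-inhabited x)
  ; L-lower     = L-low
  ; U-upper     = λ p<q (0<p , u) → <-trans 0<p p<q , U-upper x (square-< (<⇒≤ 0<p) p<q) u
  ; L-open      = L-op
  ; U-open      = U-op
  ; disjoint    = λ { (inj₁ q<0) (0<q , _) → <-asym q<0 0<q ; (inj₂ l) (_ , u) → disjoint x l u }
  ; located     = loc
  }
  where
  Lₓ Uₓ : ℚ → Set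
  Lₓ q = q < 0ℚ ⊎ L x (q * q)
  Uₓ q = 0ℚ < q × U x (q * q)

  U-inh : (∃ λ u → U x u) → ∃ λ q → Uₓ q
  U-inh (u , Uu) = [ (λ u≤1 → 1ℚ , 0<1 , U-≤ x (subst (u ≤_) (sym (*-identityʳ 1ℚ)) u≤1) Uu)
                   , (λ 1≤u → u , <-≤-trans 0<1 1≤u ,
                       U-≤ x (subst (_≤ u * u) (*-identityˡ u) (*-monoʳ-≤ {1ℚ} {u} {u} (≤-trans (<⇒≤ 0<1) 1≤u) 1≤u)) Uu) ]′
                   (≤-total u 1ℚ)

  L-low : ∀ {p q} → p < q → Lₓ q → Lₓ p
  L-low p<q (inj₁ q<0) = inj₁ (<-trans p<q q<0)
  L-low {p} {q} p<q (inj₂ l) = by (p <? 0ℚ)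
    where
    by : Dec (p < 0ℚ) → Lₓ p
    by (yes p<0) = inj₁ p<0
    by (no p≮0)  = inj₂ (L-lower x (square-< (≮⇒≥ p≮0) p<q) l)

  L-op : ∀ {q} → Lₓ q → ∃ λ r → q < r × Lₓ r
  L-op (inj₁ q<0) = let r , q<r , r<0 = <-dense q<0 in r , q<r , inj₁ r<0
  L-op {q} (inj₂ l) = by (q <? 0ℚ) (L-open x l)
    where
    by : Dec (q < 0ℚ) → (∃ λ s → q * q < s × L x s) → ∃ λ r → q < r × Lₓ r
    by (yes q<0) _ = let r , q<r , r<0 = <-dense q<0 in r , q<r , inj₁ r<0
    by (no q≮0) (s , q²<s , l′) = let r , q<r , r²≤s = square-above (≮⇒≥ q≮0) q²<s in
      r , q<r , inj₂ (L-≤ x r²≤s l′)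

  U-op : ∀ {q} → Uₓ q → ∃ λ p → p < q × Uₓ p
  U-op {q} (0<q , u) = by (U-open x u)
    where
    by : (∃ λ s → s < q * q × U x s) → ∃ λ p → p < q × Uₓ p
    by (s , s<q² , u′) = let r , 0<r , r<q , s≤r² = square-below 0<q s<q² in
      r , r<q , 0<r , U-≤ x s≤r² u′

  loc : ∀ {q r} → q < r → Lₓ q ⊎ Uₓ r
  loc {q} {r} q<r = by (q <? 0ℚ)
    where
    by : Dec (q < 0ℚ) → Lₓ q ⊎ Uₓ r
    by (yes q<0) = inj₁ (inj₁ q<0)
    by (no q≮0)  = [ (λ l → inj₁ (inj₂ l)) , (λ u → inj₂ (≤-<-trans (≮⇒≥ q≮0) q<r , u)) ]′
                   (located x (square-< (≮⇒≥ q≮0) q<r))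

0ᴿ : ℝ
0ᴿ = fromℚ 0ℚ

-- q < 1/x iff q·u < 1 for some u > x, and q > 1/x iff q·l > 1 for some 0 < l < x.
inverse : (x : ℝ) → 0ᴿ <ᴿ x → ℝ
inverse x (z , 0<z , Lz) = record
  { L           = Lₓ
  ; U           = Uₓ
  ; L-inhabited = let u , Uu = U-inhabited x in 0ℚ , u , Uu , subst (_< 1ℚ) (sym (*-zeroˡ u)) 0<1
  ; U-inhabited = U-inh (reciprocal z 0<z)
  ; L-lower     = λ {p} {q} p<q (u , Uu , qu<1) → u , Uu , <-trans (*-monoʳ-< {p} {q} {u} (0<U Uu) p<q) qu<1
  ; U-upper     = λ {p} {q} p<q (l , 0<l , Ll , 1<pl) → l , 0<l , Ll , <-trans 1<pl (*-monoʳ-< {p} {q} {l} 0<l p<q)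
  ; L-open      = λ {q} (u , Uu , qu<1) → let s , qu<s , s<1 = <-dense qu<1 ; r , q<r , ru≤s = quotient-above (0<U Uu) qu<s in
                    r , q<r , u , Uu , ≤-<-trans ru≤s s<1
  ; U-open      = λ {q} (l , 0<l , Ll , 1<ql) → let s , 1<s , s<ql = <-dense 1<ql ; r , r<q , s≤rl = quotient-below 0<l s<ql in
                    r , r<q , l , 0<l , Ll , <-≤-trans 1<s s≤rl
  ; disjoint    = λ {q} → dis {q}
  ; located     = loc
  }
  where
  Lₓ Uₓ : ℚ → Set
  Lₓ q = ∃ λ u → U x u × q * u < 1ℚ
  Uₓ q = ∃ λ l → 0ℚ < l × L x l × 1ℚ < q * l

  0<U : ∀ {u} → U x u → 0ℚ < u
  0<U Uu = <-trans 0<z (L<U x Lz Uu)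

  U-inh : (∃ λ i → 0ℚ < i × z * i ≡ 1ℚ) → ∃ λ q → Uₓ q
  U-inh (i , 0<i , zi≡1) = i + 1ℚ , z , 0<z , Lz ,
    subst (_< (i + 1ℚ) * z) (trans (*-comm i z) zi≡1) (*-monoʳ-< {i} {i + 1ℚ} {z} 0<z (p<p+d i 0<1))

  dis : ∀ {q} → Lₓ q → Uₓ q → ⊥
  dis {q} (u , Uu , qu<1) (l , 0<l , Ll , 1<ql) = by (0ℚ <? q)
    where
    by : Dec (0ℚ < q) → ⊥
    by (yes 0<q) = <-asym (<-trans 1<ql (*-monoˡ-< {l} {u} {q} 0<q (L<U x Ll Uu))) qu<1
    by (no 0≮q)  = <-asym 0<1 (<-≤-trans 1<ql (subst (q * l ≤_) (*-zeroˡ l) (*-monoʳ-≤ {q} {0ℚ} {l} (<⇒≤ 0<l) (≮⇒≥ 0≮q))))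

  loc : ∀ {q r} → q < r → Lₓ q ⊎ Uₓ r
  loc {q} {r} q<r = by (0ℚ <? q)
    where
    Lby : ∀ {i} → 0ℚ < q → q * i ≡ 1ℚ → U x i → Lₓ q
    Lby {i} 0<q qi≡1 Ui = let u , u<i , Uu = U-open x Ui in
      u , Uu , subst (q * u <_) qi≡1 (*-monoˡ-< {u} {i} {q} 0<q u<i)
    Uby : ∀ {i} → 0ℚ < r → 0ℚ < i → r * i ≡ 1ℚ → L x i → Uₓ r
    Uby {i} 0<r 0<i ri≡1 Li = let l , i<l , Ll = L-open x Li in
      l , <-trans 0<i i<l , Ll , subst (_< r * l) ri≡1 (*-monoˡ-< {i} {l} {r} 0<r i<l)
    both : 0ℚ < q → 0ℚ < r → (∃ λ i → 0ℚ < i × q * i ≡ 1ℚ) → (∃ λ j → 0ℚ < j × r * j ≡ 1ℚ) → Lₓ q ⊎ Uₓ r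
    both 0<q 0<r (i , 0<i , qi≡1) (j , 0<j , rj≡1) =
      [ (λ Lj → inj₂ (Uby 0<r 0<j rj≡1 Lj)) , (λ Ui → inj₁ (Lby 0<q qi≡1 Ui)) ]′
      (located x (reciprocal-anti 0<q q<r 0<i 0<j qi≡1 rj≡1))
    by : Dec (0ℚ < q) → Lₓ q ⊎ Uₓ r
    by (yes 0<q) = both 0<q (<-trans 0<q q<r) (reciprocal q 0<q) (reciprocal r (<-trans 0<q q<r))
    by (no 0≮q)  = let u , Uu = U-inhabited x in
      inj₁ (u , Uu , ≤-<-trans (subst (q * u ≤_) (*-zeroˡ u) (*-monoʳ-≤ {q} {0ℚ} {u} (<⇒≤ (0<U Uu)) (≮⇒≥ 0≮q))) 0<1)

-- harmonic a N = 1/(a+1) + ⋯ + 1/(a+N)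
harmonic : ℕ → ℕ → ℚ
harmonic a zero    = 0ℚ
harmonic a (suc N) = ℤ.+ 1 / suc a + harmonic (suc a) N

-- The Riemann sums Σ (1/k)·1/x of ∫₁ⁿ dx/x over the subdivision of [1,n] into (n-1)k intervals of
-- length 1/k, where k = j+1 and x runs over the right (lower sum) or the left (upper sum) endpoints
-- 1 + i/k; so the summands are 1/(k+i) with 1 ≤ i ≤ (n-1)k, respectively 0 ≤ i < (n-1)k.
lowerSum upperSum : ℕ → ℕ → ℚ
lowerSum n j = harmonic (suc j) ((n ℕ.∸ 1) ℕ.* suc j)
upperSum n j = harmonic j ((n ℕ.∸ 1) ℕ.* suc j)

harmonic-shift : ∀ a N → harmonic a N ≤ ℤ.+ 1 / suc a + harmonic (suc a) N
harmonic-shift a zero    = <⇒≤ (subst (0ℚ <_) (sym (+-identityʳ (ℤ.+ 1 / suc a))) (frac-pos 0 a))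
harmonic-shift a (suc N) = +-monoʳ-≤ (ℤ.+ 1 / suc a) (harmonic-shift (suc a) N)

unit-anti : ∀ {a b} → a ℕ.≤ b → ℤ.+ 1 / suc b ≤ ℤ.+ 1 / suc a
unit-anti {a} {b} a≤b = frac-mono 1 b 1 a (ℕ.*-monoʳ-≤ 1 (ℕ.s≤s a≤b))

harmonic-anti : ∀ a N → harmonic (suc a) N ≤ harmonic a N
harmonic-anti a zero    = ≤-refl
harmonic-anti a (suc N) = +-mono-≤ (unit-anti (ℕ.n≤1+n a)) (harmonic-anti (suc a) N)

harmonic-nonneg : ∀ a N → 0ℚ ≤ harmonic a N
harmonic-nonneg a zero    = ≤-refl
harmonic-nonneg a (suc N) = +-mono-≤ {0ℚ} {ℤ.+ 1 / suc a} (<⇒≤ (frac-pos 0 a)) (harmonic-nonneg (suc a) N)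

harmonic-++ : ∀ a M N → harmonic a (M ℕ.+ N) ≡ harmonic a M + harmonic (a ℕ.+ M) N
harmonic-++ a zero N = trans (cong (λ b → harmonic b N) (sym (ℕ.+-identityʳ a))) (sym (+-identityˡ (harmonic (a ℕ.+ 0) N)))
harmonic-++ a (suc M) N =
  trans (cong (ℤ.+ 1 / suc a +_) (trans (harmonic-++ (suc a) M N)
      (cong (λ b → harmonic (suc a) M + harmonic b N) (sym (ℕ.+-suc a M)))))
    (sym (+-assoc (ℤ.+ 1 / suc a) (harmonic (suc a) M) (harmonic (a ℕ.+ suc M) N)))

suc-mult : ∀ s x → nat (suc s) * x ≡ x + nat s * x
suc-mult s x = trans (*-distribʳ-+ x 1ℚ (nat s)) (cong (_+ nat s * x) (*-identityˡ x))

block-lower : ∀ a s b → a ℕ.+ s ℕ.≤ suc b → nat s * (ℤ.+ 1 / suc b) ≤ harmonic a s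
block-lower a zero    b h = ≤-reflexive (*-zeroˡ (ℤ.+ 1 / suc b))
block-lower a (suc s) b h = subst (_≤ harmonic a (suc s)) (sym (suc-mult s (ℤ.+ 1 / suc b)))
  (+-mono-≤ (unit-anti (ℕ.≤-trans (ℕ.m≤m+n a s) (ℕ.≤-pred h′))) (block-lower (suc a) s b h′))
  where
  h′ : suc (a ℕ.+ s) ℕ.≤ suc b
  h′ = subst (ℕ._≤ suc b) (ℕ.+-suc a s) h

block-upper : ∀ a s b → b ℕ.≤ a → harmonic a s ≤ nat s * (ℤ.+ 1 / suc b)
block-upper a zero    b h = ≤-reflexive (sym (*-zeroˡ (ℤ.+ 1 / suc b)))
block-upper a (suc s) b h = subst (harmonic a (suc s) ≤_) (sym (suc-mult s (ℤ.+ 1 / suc b)))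
  (+-mono-≤ (unit-anti h) (block-upper (suc a) s b (ℕ.m≤n⇒m≤1+n h)))

-- l/(kl) = 1/k
block-unit : ∀ k l → nat (suc l) * (ℤ.+ 1 / suc (l ℕ.+ k ℕ.* suc l)) ≡ ℤ.+ 1 / suc k
block-unit k l = trans (sym (nat-scale (suc l) (l ℕ.+ k ℕ.* suc l))) (≤-antisym
  (frac-mono (suc l) _ 1 k (ℕ.≤-reflexive eq)) (frac-mono 1 k (suc l) _ (ℕ.≤-reflexive (sym eq))))
  where
  eq : suc l ℕ.* suc k ≡ 1 ℕ.* suc (l ℕ.+ k ℕ.* suc l)
  eq = trans (ℕ.*-comm (suc l) (suc k)) (sym (ℕ.*-identityˡ (suc k ℕ.* suc l)))

refine-lower : ∀ k N l → harmonic k N ≤ harmonic (k ℕ.* suc l) (N ℕ.* suc l)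
refine-lower k zero    l = ≤-refl
refine-lower k (suc N) l = subst (harmonic k (suc N) ≤_) (sym (harmonic-++ (k ℕ.* suc l) (suc l) (N ℕ.* suc l)))
  (+-mono-≤
    (subst (_≤ harmonic (k ℕ.* suc l) (suc l)) (block-unit k l)
      (block-lower (k ℕ.* suc l) (suc l) (l ℕ.+ k ℕ.* suc l) (ℕ.≤-reflexive (ℕ.+-comm (k ℕ.* suc l) (suc l)))))
    (subst (λ a → harmonic (suc k) N ≤ harmonic a (N ℕ.* suc l)) (ℕ.+-comm (suc l) (k ℕ.* suc l))
      (refine-lower (suc k) N l)))

refine-upper : ∀ k N l → harmonic (l ℕ.+ k ℕ.* suc l) (N ℕ.* suc l) ≤ harmonic k N
refine-upper k zero    l = ≤-refl
refine-upper k (suc N) l = subst (_≤ harmonic k (suc N)) (sym (harmonic-++ (l ℕ.+ k ℕ.* suc l) (suc l) (N ℕ.* suc l)))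
  (+-mono-≤
    (subst (harmonic (l ℕ.+ k ℕ.* suc l) (suc l) ≤_) (block-unit k l)
      (block-upper (l ℕ.+ k ℕ.* suc l) (suc l) (l ℕ.+ k ℕ.* suc l) ℕ.≤-refl))
    (subst (λ a → harmonic a (N ℕ.* suc l) ≤ harmonic (suc k) N) eq (refine-upper (suc k) N l)))
  where
  eq : l ℕ.+ suc k ℕ.* suc l ≡ l ℕ.+ k ℕ.* suc l ℕ.+ suc l
  eq = trans (cong (l ℕ.+_) (ℕ.+-comm (suc l) (k ℕ.* suc l))) (sym (ℕ.+-assoc l (k ℕ.* suc l) (suc l)))

lower≤upper : ∀ n i j → lowerSum n i ≤ upperSum n j
lower≤upper n i j = ≤-trans (refine-lower (suc i) (M ℕ.* suc i) j)
  (≤-trans (harmonic-anti (j ℕ.+ i ℕ.* suc j) (M ℕ.* suc i ℕ.* suc j))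
    (subst₂ (λ a N → harmonic a N ≤ upperSum n j) eq₁ eq₂ (refine-upper j (M ℕ.* suc j) i)))
  where
  M = n ℕ.∸ 1
  eq₁ : i ℕ.+ j ℕ.* suc i ≡ j ℕ.+ i ℕ.* suc j
  eq₁ = ℕ.suc-injective (ℕ.*-comm (suc j) (suc i))
  eq₂ : M ℕ.* suc j ℕ.* suc i ≡ M ℕ.* suc i ℕ.* suc j
  eq₂ = trans (ℕ.*-assoc M (suc j) (suc i))
    (trans (cong (M ℕ.*_) (ℕ.*-comm (suc j) (suc i))) (sym (ℕ.*-assoc M (suc i) (suc j))))

-- ln n = ∫₁ⁿ dx/x for n ≥ 1; the junk value at n = 0 is 0.
ln : ℕ → ℝ
ln n = record
  { L           = Lₓ
  ; U           = Uₓ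
  ; L-inhabited = lowerSum n 0 - 1ℚ , 0 , p-1<p (lowerSum n 0)
  ; U-inhabited = upperSum n 0 + 1ℚ , 0 , p<p+d (upperSum n 0) 0<1
  ; L-lower     = λ p<q (j , q<l) → j , <-trans p<q q<l
  ; U-upper     = λ p<q (j , u<p) → j , <-trans u<p p<q
  ; L-open      = λ (j , q<l) → let r , q<r , r<l = <-dense q<l in r , q<r , j , r<l
  ; U-open      = λ (j , u<q) → let r , u<r , r<q = <-dense u<q in r , r<q , j , u<r
  ; disjoint    = λ (i , q<l) (j , u<q) → <-irrefl refl (<-trans (<-≤-trans q<l (lower≤upper n i j)) u<q)
  ; located     = λ {q} {r} q<r → loc q<r (small-unit-fraction (r - q) (diff-pos q<r))
  }
  where
  Lₓ Uₓ : ℚ → Set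
  Lₓ q = ∃ λ j → q < lowerSum n j
  Uₓ q = ∃ λ j → upperSum n j < q

  loc : ∀ {q r} → q < r → (∃ λ j → ℤ.+ 1 / suc j < r - q) → Lₓ q ⊎ Uₓ r
  loc {q} {r} q<r (j , small) = by (q <? lowerSum n j)
    where
    by : Dec (q < lowerSum n j) → Lₓ q ⊎ Uₓ r
    by (yes q<l) = inj₁ (j , q<l)
    by (no q≮l)  = inj₂ (j , ≤-<-trans (harmonic-shift j ((n ℕ.∸ 1) ℕ.* suc j))
      (subst (ℤ.+ 1 / suc j + lowerSum n j <_) (trans (+-comm (r - q) q) (sym (add-diff q r)))
        (+-mono-<-≤ small (≮⇒≥ q≮l))))

ln-positive : ∀ {n} → 1 ℕ.< n → 0ᴿ <ᴿ ln n
ln-positive {suc (suc n)} _ = let q , 0<q , q<l = <-dense 0<lower in q , 0<q , 0 , q<l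
  where
  0<lower : 0ℚ < lowerSum (suc (suc n)) 0
  0<lower = +-mono-<-≤ {0ℚ} {ℤ.+ 1 / 2} (frac-pos 0 1) (harmonic-nonneg 2 (n ℕ.* 1))
ln-positive {suc zero} (ℕ.s≤s ())

-- The vertex set is Fin order, without loss of generality.
record Hypergraph : Set where
  field
    order    : ℕ
    edges    : List (Subset order)
    distinct : Unique edges

  Vertex : Set
  Vertex = Fin order

  #edges : ℕ
  #edges = List.length edges

open Hypergraph

Uniform : ℕ → Hypergraph → Set
Uniform n H = All (λ e → card e ≡ n) (edges H)

data Colour : Set where
  one two : Colour

_≟ᶜ_ : DecidableEquality Colour
one ≟ᶜ one = yes refl
one ≟ᶜ two = no λ ()
two ≟ᶜ one = no λ ()
two ≟ᶜ two = yes refl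

Monochromatic : ∀ {m} → (Fin m → Colour) → Subset m → Set
Monochromatic χ e = ∃ λ j → ∀ v → v ∈ e → χ v ≡ j

Proper : (H : Hypergraph) → (Vertex H → Colour) → Set
Proper H χ = All (λ e → ¬ Monochromatic χ e) (edges H)

PartialColouring : Hypergraph → Set
PartialColouring H = Vertex H → Maybe Colour

assign : ∀ H → PartialColouring H → Vertex H → Colour → PartialColouring H
assign H χ v j = Vector.updateAt χ v (const (just j))

-- Giving v the colour j creates a monochromatic edge whose last vertex is v.  Here χ is the partial
-- colouring of the vertices born before v, so an edge through v has v as its last vertex exactly when
-- all of it is coloured once v is.
Creates : ∀ H → PartialColouring H → Vertex H → Colour → Set
Creates H χ v j = Any (λ e → v ∈ e × (∀ w → w ∈ e → assign H χ v j w ≡ just j)) (edges H)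

creates? : ∀ H χ v j → Dec (Creates H χ v j)
creates? H χ v j = any? (λ e → (v ∈? e) ×-dec
  Fin.all? (λ w → (w ∈? e) →-dec Maybe.≡-dec _≟ᶜ_ (assign H χ v j w) (just j))) (edges H)

-- If colour one is not allowed, the answer is two whether or not two is allowed.
choose : ∀ H → PartialColouring H → Vertex H → Colour
choose H χ v with creates? H χ v one
... | no  _ = one
... | yes _ = two

greedyStep : ∀ H → PartialColouring H → Vertex H → PartialColouring H
greedyStep H χ v = assign H χ v (choose H χ v)

-- The output when the vertices are processed in the order of the list vs.  The default value of
-- fromMaybe is not used when vs enumerates all the vertices.
greedy : ∀ H → List (Vertex H) → Vertex H → Colour
greedy H vs v = fromMaybe two (foldl (greedyStep H) (const nothing) vs v)

BirthTimes : ℕ → Set₁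
BirthTimes m = Fin m → ℝ

IncreasingOrder : ∀ {m} → BirthTimes m → List (Fin m) → Set
IncreasingOrder {m} t vs = vs ↭ allFin m × AllPairs (λ v w → t v <ᴿ t w) vs

GreedyProper : (H : Hypergraph) → BirthTimes (order H) → Set
GreedyProper H t = ∃ λ vs → IncreasingOrder t vs × Proper H (greedy H vs)

Injective : ∀ {m} → BirthTimes m → Set
Injective t = ∀ {v w} → v ≢ w → t v <ᴿ t w ⊎ t w <ᴿ t v

-- Products of closed rational subintervals of [0,1].
record Box (m : ℕ) : Set where
  field
    lo hi : Fin m → ℚ
    0≤lo  : ∀ v → 0ℚ ≤ lo v
    lo≤hi : ∀ v → lo v ≤ hi v
    hi≤1  : ∀ v → hi v ≤ 1ℚ

  volume : ℚ
  volume = Vector.foldr _*_ 1ℚ (λ v → hi v - lo v)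

open Box

_∈ᴮ_ : ∀ {m} → BirthTimes m → Box m → Set
t ∈ᴮ b = ∀ v → fromℚ (lo b v) ≤ᴿ t v × t v ≤ᴿ fromℚ (hi b v)

NonOverlapping : ∀ {m} → Box m → Box m → Set
NonOverlapping b b′ = ∃ λ v → hi b v ≤ lo b′ v ⊎ hi b′ v ≤ lo b v

infix 4 _<Pr_

-- q <Pr A states that the probability of the event A exceeds q when the birth times are independent and
-- uniform on [0,1], that is, for Lebesgue measure on [0,1]ᵐ: finitely many non-overlapping boxes
-- of total volume greater than q lie in A up to the null set of non-injective t.  The supremum of these q
-- is the inner Jordan content of A; it is the measure of A for the events which depend only on the
-- order of the birth times, as each possible order cuts out a simplex {t : t(v₁) < ⋯ < t(vₘ)}.
_<Pr_ : ∀ {m} → ℚ → (BirthTimes m → Set) → Set₁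
_<Pr_ {m} q A = Σ (List (Box m)) λ bs →
  AllPairs NonOverlapping bs ×
  All (λ b → ∀ t → t ∈ᴮ b → Injective t → A t) bs ×
  q < List.foldr _+_ 0ℚ (map volume bs)

{-# OPTIONS --safe #-}

-- If the algorithm fails, some edge f is monochromatic of colour two; its first vertex v got that colour
-- as the last vertex of an edge e whose other vertices have colour one, so e ∩ f = {v}.  Split [0,1] into
-- a middle part of length p and two outer parts of length (1-p)/2.  Then e lies in the left part, or f in
-- the right part, or v is born in the middle part at some time t, with e before t and f after t.  With
-- |E| = x 2ⁿ⁻¹ the union bound gives failure probability at most x (1-p)ⁿ + x² p, as t(1-t) ≤ 1/4.
-- For p = h/2n with h = 1/2 + ⋯ + 1/n ≤ ln n, the second term is at most c²/2 < 1 and the square of the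
-- first is at most 4/h.  All this is done with integer birth times below a large K, which costs a factor
-- (1 + 1/K)²ⁿ⁻² in the second term.  An order of the vertices for which the algorithm succeeds gives a box of
-- positive volume, which is all that positive probability requires.

module Submission where

module RandomGreedy where

  open import Algebra.Bundles using (CommutativeRing)
  open import Data.Bool.Base using (Bool; true; false; if_then_else_; T)
  open import Data.Empty using (⊥-elim)
  open import Data.Fin.Base using (Fin; zero; suc)
  import Data.Fin.Properties as Fin
  open import Data.Fin.Subset using (Subset; Nonempty; _∈_; _∩_; ∁; ⁅_⁆) renaming (∣_∣ to card)
  open import Data.Fin.Subset.Properties
    using (_∈?_; nonempty?; Empty-unique; ∣⊥∣≡0; ⊆-antisym; x∈⁅x⁆; x∈⁅y⁆⇒x≡y; x∈p∩q⁺; x∈p∩q⁻; ∣⁅x⁆∣≡1; ∩-comm)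
  import Data.Integer.Base as ℤ
  open import Data.List.Base as List using (List; []; _∷_; _++_; concatMap; foldl; length; upTo; allFin)
  open import Data.List.Membership.DecPropositional using () renaming (_∈?_ to mem?)
  open import Data.List.Membership.Propositional using (find; lose) renaming (_∈_ to _∈ˡ_; _∉_ to _∉ˡ_)
  open import Data.List.Membership.Propositional.Properties
    using (∈-++⁺ʳ; ∈-++⁻; ∈-concatMap⁺; ∈-upTo⁺; ∈-upTo⁻; ∈-allFin)
  open import Data.List.Properties using (foldl-++; length-upTo)
  open import Data.List.Relation.Binary.Permutation.Propositional using (_↭_; ↭-sym; ↭⇒↭ₛ)
  open import Data.List.Relation.Binary.Permutation.Propositional.Properties using (∈-resp-↭)
  open import Data.List.Relation.Binary.Permutation.Setoid.Properties using (Unique-resp-↭)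
  open import Data.List.Relation.Unary.All as All using (All; []; _∷_)
  open import Data.List.Relation.Unary.AllPairs as AllPairs using (AllPairs; []; _∷_)
  open import Data.List.Relation.Unary.Any as Any using (Any; here; there)
  open import Data.List.Relation.Unary.Sorted.TotalOrder.Properties using (Sorted⇒AllPairs)
  open import Data.List.Relation.Unary.Unique.Propositional using (Unique)
  open import Data.List.Relation.Unary.Unique.Propositional.Properties using (allFin⁺)
  import Data.List.Sort as Sort
  open import Data.Maybe.Base using (just; nothing; fromMaybe)
  open import Data.Nat.Base as ℕ using (ℕ; zero; suc; _≤ᵇ_; _<ᵇ_; _≡ᵇ_; _∸_)
  import Data.Nat.Properties as ℕ
  open import Data.Product using (∃; _×_; _,_; proj₁; proj₂)
  open import Data.Rational.Base hiding (_≤ᵇ_)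
  open import Data.Rational.Properties hiding (≡-setoid)
  open import Data.Rational.Solver using (module +-*-Solver)
  open import Data.Sum using (inj₁; inj₂; [_,_]′)
  open import Data.Unit.Base using (tt)
  open import Data.Vec.Base using ([]; _∷_; lookup)
  import Data.Vec.Functional as Vector
  open import Data.Vec.Functional.Properties using (updateAt-updates; updateAt-minimal)
  open import Data.Vec.Properties using (lookup⇒[]=)
  open import Function.Base using (_∘_; const; id)
  import Relation.Binary.Construct.On as On
  open import Relation.Binary.PropositionalEquality
  open import Relation.Nullary using (¬_; yes; no)
  open import Relation.Unary using (Decidable)
  open import Defs hiding (base; step)
  open import Algebra.Properties.CommutativeSemiring.Exp
    (CommutativeRing.commutativeSemiring +-*-commutativeRing) using (_^_; ^-homo-*; ^-distrib-*)

  open +-*-Solver using (solve; _:=_; _:+_; _:*_; _:-_; :-_; con)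
  open ℝ
  open Hypergraph
  open Box

  -- Natural numbers and powers inside the rationals

  nat-+ : ∀ m n → nat (m ℕ.+ n) ≡ nat m + nat n
  nat-+ zero    n = sym (+-identityˡ (nat n))
  nat-+ (suc m) n = trans (cong (1ℚ +_) (nat-+ m n)) (sym (+-assoc 1ℚ (nat m) (nat n)))

  nat-* : ∀ m n → nat (m ℕ.* n) ≡ nat m * nat n
  nat-* zero    n = sym (*-zeroˡ (nat n))
  nat-* (suc m) n = trans (nat-+ n (m ℕ.* n)) (trans (cong (nat n +_) (nat-* m n)) (sym (suc-mult m (nat n))))

  nat-nonneg : ∀ n → 0ℚ ≤ nat n
  nat-nonneg zero    = ≤-refl
  nat-nonneg (suc n) = +-mono-≤ (<⇒≤ 0<1) (nat-nonneg n)

  nat-mono : ∀ {m n} → m ℕ.≤ n → nat m ≤ nat n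
  nat-mono {n = n} ℕ.z≤n = nat-nonneg n
  nat-mono (ℕ.s≤s m≤n)   = +-monoʳ-≤ 1ℚ (nat-mono m≤n)

  *-mono-≤ : ∀ {p q r s} → 0ℚ ≤ p → 0ℚ ≤ s → p ≤ q → r ≤ s → p * r ≤ q * s
  *-mono-≤ 0≤p 0≤s p≤q r≤s = ≤-trans (*-monoˡ-≤ 0≤p r≤s) (*-monoʳ-≤ 0≤s p≤q)

  ^-nonneg : ∀ {p} n → 0ℚ ≤ p → 0ℚ ≤ p ^ n
  ^-nonneg zero    0≤p = <⇒≤ 0<1
  ^-nonneg (suc n) 0≤p = *-nonneg 0≤p (^-nonneg n 0≤p)

  ^-mono : ∀ {p q} n → 0ℚ ≤ p → p ≤ q → p ^ n ≤ q ^ n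
  ^-mono zero    0≤p p≤q = ≤-refl
  ^-mono (suc n) 0≤p p≤q = *-mono-≤ 0≤p (^-nonneg n (≤-trans 0≤p p≤q)) p≤q (^-mono n 0≤p p≤q)

  -- Sums over initial segments of ℕ

  ∑< : ℕ → (ℕ → ℚ) → ℚ
  ∑< zero    f = 0ℚ
  ∑< (suc K) f = f K + ∑< K f

  infix 5 ∑<
  syntax ∑< K (λ i → x) = ∑[ i < K ] x

  ∑-cong : ∀ K {f g} → (∀ i → f i ≡ g i) → ∑< K f ≡ ∑< K g
  ∑-cong zero    f≡g = refl
  ∑-cong (suc K) f≡g = cong₂ _+_ (f≡g K) (∑-cong K f≡g)

  ∑-zero : ∀ K → ∑[ i < K ] 0ℚ ≡ 0ℚ
  ∑-zero zero    = refl
  ∑-zero (suc K) = trans (+-identityˡ _) (∑-zero K)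

  ∑-one : ∀ K → ∑[ i < K ] 1ℚ ≡ nat K
  ∑-one zero    = refl
  ∑-one (suc K) = cong (1ℚ +_) (∑-one K)

  ∑-+ : ∀ K f g → ∑[ i < K ] (f i + g i) ≡ ∑< K f + ∑< K g
  ∑-+ zero    f g = refl
  ∑-+ (suc K) f g = trans (cong (f K + g K +_) (∑-+ K f g)) (lemma (f K) (g K) (∑< K f) (∑< K g))
    where
    lemma : ∀ a b c d → a + b + (c + d) ≡ (a + c) + (b + d)
    lemma = solve 4 (λ a b c d → a :+ b :+ (c :+ d) := (a :+ c) :+ (b :+ d)) refl

  ∑-*ʳ : ∀ K f c → ∑[ i < K ] (f i * c) ≡ ∑< K f * c
  ∑-*ʳ zero    f c = sym (*-zeroˡ c)
  ∑-*ʳ (suc K) f c = trans (cong (f K * c +_) (∑-*ʳ K f c)) (sym (*-distribʳ-+ c (f K) (∑< K f)))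

  -- Averaging: were all `K` terms at least 1, the sum would be at least `nat K`.
  ∑<K⇒∃<1 : ∀ K f → ∑< K f < nat K → ∃ λ i → i ℕ.< K × f i < 1ℚ
  ∑<K⇒∃<1 zero    f h = ⊥-elim (<-irrefl refl h)
  ∑<K⇒∃<1 (suc K) f h with f K <? 1ℚ
  ... | yes fK<1 = K , ℕ.≤-refl , fK<1
  ... | no  fK≮1 with ∑< K f <? nat K
  ...   | yes h′ = let i , i<K , fi<1 = ∑<K⇒∃<1 K f h′ in i , ℕ.m≤n⇒m≤1+n i<K , fi<1
  ...   | no  h′ = ⊥-elim (<-irrefl refl (<-≤-trans h (+-mono-≤ (≮⇒≥ fK≮1) (≮⇒≥ h′))))

  -- Union bound over rectangles

  -- The sides are given by their characteristic functions, and the birth times are K equally likely integers.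
  Rectangle : ℕ → Set
  Rectangle m = Fin m → ℕ → Bool

  ⟦_⟧ : Bool → ℚ
  ⟦ b ⟧ = if b then 1ℚ else 0ℚ

  #< : ℕ → (ℕ → Bool) → ℚ
  #< K b = ∑[ i < K ] ⟦ b i ⟧

  ⟦⟧-nonneg : ∀ b → 0ℚ ≤ ⟦ b ⟧
  ⟦⟧-nonneg true  = <⇒≤ 0<1
  ⟦⟧-nonneg false = ≤-refl

  ⟦⟧≤1 : ∀ b → ⟦ b ⟧ ≤ 1ℚ
  ⟦⟧≤1 true  = ≤-refl
  ⟦⟧≤1 false = <⇒≤ 0<1

  #-nonneg : ∀ K b → 0ℚ ≤ #< K b
  #-nonneg zero    b = ≤-refl
  #-nonneg (suc K) b = +-mono-≤ (⟦⟧-nonneg (b K)) (#-nonneg K b)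

  #≤K : ∀ K b → #< K b ≤ nat K
  #≤K zero    b = ≤-refl
  #≤K (suc K) b = +-mono-≤ (⟦⟧≤1 (b K)) (#≤K K b)

  #-< : ∀ K a → #< K (_<ᵇ a) ≤ nat a
  #-< zero    a = nat-nonneg a
  #-< (suc K) a with K <ᵇ a in eq
  ... | true  = ≤-trans (+-monoʳ-≤ 1ℚ (#≤K K (_<ᵇ a))) (nat-mono (ℕ.<ᵇ⇒< K a (subst T (sym eq) tt)))
  ... | false = subst (_≤ nat a) (sym (+-identityˡ (#< K (_<ᵇ a)))) (#-< K a)

  #-≤ : ∀ K i → #< K (_≤ᵇ i) ≤ nat (suc i)
  #-≤ zero    i = nat-nonneg (suc i)
  #-≤ (suc K) i with K ≤ᵇ i in eq
  ... | true  = ≤-trans (+-monoʳ-≤ 1ℚ (#≤K K (_≤ᵇ i))) (nat-mono (ℕ.s≤s (ℕ.≤ᵇ⇒≤ K i (subst T (sym eq) tt))))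
  ... | false = subst (_≤ nat (suc i)) (sym (+-identityˡ (#< K (_≤ᵇ i)))) (#-≤ K i)

  #-≥-empty : ∀ K i → K ℕ.≤ i → #< K (i ≤ᵇ_) ≡ 0ℚ
  #-≥-empty zero    i h = refl
  #-≥-empty (suc K) i h with i ≤ᵇ K in eq
  ... | true  = ⊥-elim (ℕ.<-irrefl refl (ℕ.≤-trans h (ℕ.≤ᵇ⇒≤ i K (subst T (sym eq) tt))))
  ... | false = trans (+-identityˡ _) (#-≥-empty K i (ℕ.<⇒≤ h))

  #-≥ : ∀ K i → #< K (i ≤ᵇ_) ≤ nat (K ∸ i)
  #-≥ K i with i ℕ.≤? K
  ... | no i≰K = subst (_≤ nat (K ∸ i)) (sym (#-≥-empty K i (ℕ.≰⇒≥ i≰K))) (nat-nonneg (K ∸ i))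
  #-≥ zero    i | yes _ = nat-nonneg (0 ∸ i)
  #-≥ (suc K) i | yes i≤1+K with i ≤ᵇ K in eq
  ... | true  = subst (1ℚ + #< K (i ≤ᵇ_) ≤_) (cong nat (sym (ℕ.+-∸-assoc 1 (ℕ.≤ᵇ⇒≤ i K (subst T (sym eq) tt)))))
                  (+-monoʳ-≤ 1ℚ (#-≥ K i))
  -- Here `i` is `suc K`, so no time up to `K` reaches it.
  ... | false = subst (_≤ nat (suc K ∸ i))
                  (sym (trans (+-identityˡ _) (#-≥-empty K i (ℕ.≮⇒≥ λ i<K → subst T eq (ℕ.≤⇒≤ᵇ (ℕ.<⇒≤ i<K))))))
                  (nat-nonneg (suc K ∸ i))

  #-≡-empty : ∀ K i → K ℕ.≤ i → #< K (_≡ᵇ i) ≡ 0ℚ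
  #-≡-empty zero    i h = refl
  #-≡-empty (suc K) i h with K ≡ᵇ i in eq
  ... | true  = ⊥-elim (ℕ.<-irrefl (ℕ.≡ᵇ⇒≡ K i (subst T (sym eq) tt)) h)
  ... | false = trans (+-identityˡ _) (#-≡-empty K i (ℕ.<⇒≤ h))

  #-≡ : ∀ K i → #< K (_≡ᵇ i) ≤ 1ℚ
  #-≡ zero    i = <⇒≤ 0<1
  #-≡ (suc K) i with K ≡ᵇ i in eq
  ... | true  = ≤-reflexive (cong (1ℚ +_) (#-≡-empty K i (ℕ.≤-reflexive (ℕ.≡ᵇ⇒≡ K i (subst T (sym eq) tt)))))
  ... | false = subst (_≤ 1ℚ) (sym (+-identityˡ (#< K (_≡ᵇ i)))) (#-≡ K i)

  Avoids : ∀ {m} → (Fin m → ℕ) → Rectangle m → Set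
  Avoids s R = ∃ λ v → R v (s v) ≡ false

  -- `ε` is 1/`K`, so `measure R` is the fraction of the integer points with coordinates below `K`
  -- that lie in `R`.
  module Uniform-measure (K : ℕ) (ε : ℚ) (Kε≡1 : nat K * ε ≡ 1ℚ) (0<ε : 0ℚ < ε) where

    measure : ∀ {m} → Rectangle m → ℚ
    measure {zero}  R = 1ℚ
    measure {suc m} R = #< K (R zero) * ε * measure (λ v → R (suc v))

    side-nonneg : ∀ b → 0ℚ ≤ #< K b * ε
    side-nonneg b = *-nonneg (#-nonneg K b) (<⇒≤ 0<ε)

    measure-nonneg : ∀ {m} (R : Rectangle m) → 0ℚ ≤ measure R
    measure-nonneg {zero}  R = <⇒≤ 0<1
    measure-nonneg {suc m} R = *-nonneg (side-nonneg (R zero)) (measure-nonneg (λ v → R (suc v)))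

    total : ∀ {m} → List (Rectangle m) → ℚ
    total = List.foldr (λ R q → measure R + q) 0ℚ

    fibre : ∀ {m} → ℕ → List (Rectangle (suc m)) → List (Rectangle m)
    fibre i []       = []
    fibre i (R ∷ Rs) = if R zero i then (λ v → R (suc v)) ∷ fibre i Rs else fibre i Rs

    total-fibre-∷ : ∀ {m} i (R : Rectangle (suc m)) Rs →
      total (fibre i (R ∷ Rs)) ≡ ⟦ R zero i ⟧ * measure (λ v → R (suc v)) + total (fibre i Rs)
    total-fibre-∷ i R Rs with R zero i
    ... | true  = cong (_+ total (fibre i Rs)) (sym (*-identityˡ (measure (λ v → R (suc v)))))
    ... | false = sym (trans (cong (_+ total (fibre i Rs)) (*-zeroˡ (measure (λ v → R (suc v)))))
                             (+-identityˡ (total (fibre i Rs))))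

    -- Each `R` contributes the measure of its remaining sides once for every `i` on its first side.
    -- So the fibre totals average to the total, which allows one coordinate to be fixed at a time.
    fubini : ∀ {m} (Rs : List (Rectangle (suc m))) → (∑[ i < K ] total (fibre i Rs)) * ε ≡ total Rs
    fubini []       = trans (cong (_* ε) (∑-zero K)) (*-zeroˡ ε)
    fubini (R ∷ Rs) = trans (cong (_* ε) sum≡) (trans (lemma (#< K (R zero)) μ (∑[ i < K ] total (fibre i Rs)) ε)
      (cong (#< K (R zero) * ε * μ +_) (fubini Rs)))
      where
      μ : ℚ
      μ = measure (λ v → R (suc v))
      sum≡ : ∑[ i < K ] total (fibre i (R ∷ Rs)) ≡ #< K (R zero) * μ + (∑[ i < K ] total (fibre i Rs))
      sum≡ = trans (∑-cong K (λ i → total-fibre-∷ i R Rs))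
        (trans (∑-+ K (λ i → ⟦ R zero i ⟧ * μ) (λ i → total (fibre i Rs)))
          (cong (_+ (∑[ i < K ] total (fibre i Rs))) (∑-*ʳ K (λ i → ⟦ R zero i ⟧) μ)))
      lemma : ∀ a μ b ε → (a * μ + b) * ε ≡ a * ε * μ + b * ε
      lemma = solve 4 (λ a μ b ε → (a :* μ :+ b) :* ε := a :* ε :* μ :+ b :* ε) refl

    avoids-fibre : ∀ {m} i (s : Fin m → ℕ) Rs → All (Avoids s) (fibre i Rs) → All (Avoids (i Vector.∷ s)) Rs
    avoids-fibre i s []       h = []
    avoids-fibre i s (R ∷ Rs) h with R zero i in eq
    ... | false = (zero , eq) ∷ avoids-fibre i s Rs h
    avoids-fibre i s (R ∷ Rs) ((v , Rv) ∷ h) | true = (suc v , Rv) ∷ avoids-fibre i s Rs h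

    total-nonneg : ∀ {m} (Rs : List (Rectangle m)) → 0ℚ ≤ total Rs
    total-nonneg []       = ≤-refl
    total-nonneg (R ∷ Rs) = +-mono-≤ (measure-nonneg R) (total-nonneg Rs)

    -- The coordinates are chosen one at a time, keeping the total measure of the fibres below 1.
    union-bound : ∀ {m} (Rs : List (Rectangle m)) → total Rs < 1ℚ →
                  ∃ λ s → (∀ v → s v ℕ.< K) × All (Avoids s) Rs
    union-bound {zero}  []       h = (λ ()) , (λ ()) , []
    -- In dimension 0 every rectangle has measure 1, so a total below 1 forces the empty list.
    union-bound {zero}  (R ∷ Rs) h = ⊥-elim (<-irrefl refl (<-≤-trans h (p≤p+d 1ℚ (total-nonneg Rs))))
    union-bound {suc m} Rs       h = extend (∑<K⇒∃<1 K (λ i → total (fibre i Rs)) S<K)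
      where
      S : ℚ
      S = ∑[ i < K ] total (fibre i Rs)
      S<K : S < nat K
      S<K = ≰⇒> λ K≤S → <-irrefl refl (<-≤-trans (subst (_< 1ℚ) (sym (fubini Rs)) h)
        (subst (_≤ S * ε) Kε≡1 (*-monoʳ-≤ (<⇒≤ 0<ε) K≤S)))
      extend : (∃ λ i → i ℕ.< K × total (fibre i Rs) < 1ℚ) → ∃ λ s → (∀ v → s v ℕ.< K) × All (Avoids s) Rs
      extend (i , i<K , small) = let s , s<K , avoids = union-bound (fibre i Rs) small in
        i Vector.∷ s , (λ { zero → i<K ; (suc v) → s<K v }) , avoids-fibre i s Rs avoids

    total-++ : ∀ {m} (Rs Ss : List (Rectangle m)) → total (Rs ++ Ss) ≡ total Rs + total Ss
    total-++ []       Ss = sym (+-identityˡ (total Ss))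
    total-++ (R ∷ Rs) Ss = trans (cong (measure R +_) (total-++ Rs Ss)) (sym (+-assoc (measure R) (total Rs) (total Ss)))

    total-concatMap : ∀ {m} {A : Set} {B} (g : A → List (Rectangle m)) xs →
      All (λ x → total (g x) ≤ B) xs → total (concatMap g xs) ≤ nat (length xs) * B
    total-concatMap {B = B} g []       []       = ≤-reflexive (sym (*-zeroˡ B))
    total-concatMap {B = B} g (x ∷ xs) (h ∷ hs) = subst₂ _≤_ (sym (total-++ (g x) (concatMap g xs))) (sym (suc-mult (length xs) B))
      (+-mono-≤ h (total-concatMap g xs hs))

    full : #< K (λ _ → true) * ε ≡ 1ℚ
    full = trans (cong (_* ε) (∑-one K)) Kε≡1

    within : ∀ {m} → (ℕ → Bool) → Subset m → Rectangle m
    within b e v x = if lookup e v then b x else true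

    measure-within : ∀ {m} b (e : Subset m) → measure (within b e) ≡ (#< K b * ε) ^ card e
    measure-within b []          = refl
    measure-within b (true ∷ e)  = cong (#< K b * ε *_) (measure-within b e)
    measure-within b (false ∷ e) = trans (cong (_* measure (within b e)) full) (trans (*-identityˡ _) (measure-within b e))

    -- That `e` is born by time `i` and `f` from time `i` on is a product of conditions on single
    -- vertices: a common vertex must be born exactly at `i`.
    crossing-side : ℕ → Bool → Bool → ℕ → Bool
    crossing-side i true  true  = _≡ᵇ i
    crossing-side i true  false = _≤ᵇ i
    crossing-side i false true  = i ≤ᵇ_
    crossing-side i false false = λ _ → true

    crossing : ∀ {m} → Subset m → Subset m → ℕ → Rectangle m
    crossing e f i v = crossing-side i (lookup e v) (lookup f v)

    measure-crossing : ∀ {m} (e f : Subset m) i → measure (crossing e f i) ≡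
      (#< K (_≡ᵇ i) * ε) ^ card (e ∩ f) * (#< K (_≤ᵇ i) * ε) ^ card (e ∩ ∁ f) * (#< K (i ≤ᵇ_) * ε) ^ card (f ∩ ∁ e)
    measure-crossing [] [] i = refl
    measure-crossing (true ∷ e) (true ∷ f) i = trans (cong (#< K (_≡ᵇ i) * ε *_) (measure-crossing e f i))
      (lemma (#< K (_≡ᵇ i) * ε) ((#< K (_≡ᵇ i) * ε) ^ card (e ∩ f)) ((#< K (_≤ᵇ i) * ε) ^ card (e ∩ ∁ f)) ((#< K (i ≤ᵇ_) * ε) ^ card (f ∩ ∁ e)))
      where
      lemma : ∀ b x y z → b * (x * y * z) ≡ b * x * y * z
      lemma = solve 4 (λ b x y z → b :* (x :* y :* z) := b :* x :* y :* z) refl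
    measure-crossing (true ∷ e) (false ∷ f) i = trans (cong (#< K (_≤ᵇ i) * ε *_) (measure-crossing e f i))
      (lemma (#< K (_≤ᵇ i) * ε) ((#< K (_≡ᵇ i) * ε) ^ card (e ∩ f)) ((#< K (_≤ᵇ i) * ε) ^ card (e ∩ ∁ f)) ((#< K (i ≤ᵇ_) * ε) ^ card (f ∩ ∁ e)))
      where
      lemma : ∀ b x y z → b * (x * y * z) ≡ x * (b * y) * z
      lemma = solve 4 (λ b x y z → b :* (x :* y :* z) := x :* (b :* y) :* z) refl
    measure-crossing (false ∷ e) (true ∷ f) i = trans (cong (#< K (i ≤ᵇ_) * ε *_) (measure-crossing e f i))
      (lemma (#< K (i ≤ᵇ_) * ε) ((#< K (_≡ᵇ i) * ε) ^ card (e ∩ f)) ((#< K (_≤ᵇ i) * ε) ^ card (e ∩ ∁ f)) ((#< K (i ≤ᵇ_) * ε) ^ card (f ∩ ∁ e)))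
      where
      lemma : ∀ b x y z → b * (x * y * z) ≡ x * y * (b * z)
      lemma = solve 4 (λ b x y z → b :* (x :* y :* z) := x :* y :* (b :* z)) refl
    measure-crossing (false ∷ e) (false ∷ f) i =
      trans (cong (_* measure (crossing e f i)) full) (trans (*-identityˡ _) (measure-crossing e f i))

  -- The greedy algorithm

  module _ {A : Set} {P : A → Set} (P? : Decidable P) where

    split-first : ∀ vs → Any P vs → ∃ λ xs → ∃ λ v → ∃ λ ys → vs ≡ xs ++ v ∷ ys × P v × All (¬_ ∘ P) xs
    split-first (x ∷ vs) h with P? x
    ... | yes px = [] , x , vs , refl , px , []
    ... | no ¬px with split-first vs (Any.tail ¬px h)
    ...   | xs , v , ys , refl , pv , ¬pxs = x ∷ xs , v , ys , refl , pv , ¬px ∷ ¬pxs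

    split-last : ∀ vs → Any P vs → ∃ λ xs → ∃ λ v → ∃ λ ys → vs ≡ xs ++ v ∷ ys × P v × All (¬_ ∘ P) ys
    split-last (x ∷ vs) h with Any.any? P? vs
    split-last (x ∷ vs) h         | yes h′ with split-last vs h′
    ... | xs , v , ys , refl , pv , ¬pys = x ∷ xs , v , ys , refl , pv , ¬pys
    split-last (x ∷ vs) (here px) | no ¬h  = [] , x , vs , refl , px , All.tabulate λ w∈ pw → ¬h (lose w∈ pw)
    split-last (x ∷ vs) (there h) | no ¬h  = ⊥-elim (¬h h)

  AllPairs-++ : ∀ {A : Set} {R : A → A → Set} xs {ys} → AllPairs R (xs ++ ys) →
                ∀ {x y} → x ∈ˡ xs → y ∈ˡ ys → R x y
  AllPairs-++ (x ∷ xs) (Rx ∷ _) (here refl) y∈ = All.lookup Rx (∈-++⁺ʳ xs y∈)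
  AllPairs-++ (x ∷ xs) (_ ∷ h)  (there x∈)  y∈ = AllPairs-++ xs h x∈ y∈

  AllPairs-++ʳ : ∀ {A : Set} {R : A → A → Set} xs {ys} → AllPairs R (xs ++ ys) → AllPairs R ys
  AllPairs-++ʳ []       h       = h
  AllPairs-++ʳ (x ∷ xs) (_ ∷ h) = AllPairs-++ʳ xs h

  module Greedy (H : Hypergraph) where

    run : PartialColouring H → List (Vertex H) → PartialColouring H
    run = foldl (greedyStep H)

    run-untouched : ∀ χ vs {w} → w ∉ˡ vs → run χ vs w ≡ χ w
    run-untouched χ []       w∉ = refl
    run-untouched χ (v ∷ vs) w∉ = trans (run-untouched (greedyStep H χ v) vs (w∉ ∘ there))
      (updateAt-minimal _ v χ (w∉ ∘ here))

    run-chosen : ∀ χ v vs → v ∉ˡ vs → run χ (v ∷ vs) v ≡ just (choose H χ v)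
    run-chosen χ v vs v∉ = trans (run-untouched (greedyStep H χ v) vs v∉) (updateAt-updates v χ)

    -- In a duplicate-free list a vertex is coloured only at its own turn. So the colours on `xs`
    -- seen by the step at `v` are final, and so is the colour it chooses.
    module At {xs : List (Vertex H)} {v : Vertex H} {ys : List (Vertex H)} (unique : Unique (xs ++ v ∷ ys)) where

      before : PartialColouring H
      before = run (const nothing) xs

      after : Vertex H → Colour
      after = greedy H (xs ++ v ∷ ys)

      v∉ys : v ∉ˡ ys
      v∉ys v∈ = All.lookup (AllPairs.head (AllPairs-++ʳ xs unique)) v∈ refl

      final : PartialColouring H
      final = run (const nothing) (xs ++ v ∷ ys)

      final≡ : ∀ w → final w ≡ run before (v ∷ ys) w
      final≡ w = cong (λ χ → χ w) (foldl-++ (greedyStep H) (const nothing) xs (v ∷ ys))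

      after-chosen : after v ≡ choose H before v
      after-chosen = cong (fromMaybe two) (trans (final≡ v) (run-chosen before v ys v∉ys))

      before-final : ∀ {w} → w ∈ˡ xs → before w ≡ final w
      before-final w∈ = sym (trans (final≡ _) (run-untouched before (v ∷ ys) λ w∈′ → AllPairs-++ xs unique w∈ w∈′ refl))

      before-one : ∀ {w} → w ∈ˡ xs → after w ≡ one → before w ≡ just one
      before-one {w} w∈ eq = trans (before-final w∈) (aux (final w) eq)
        where
        -- The default of `fromMaybe` is `two`, so the output `one` can only come from an actual
        -- assignment.
        aux : ∀ c → fromMaybe two c ≡ one → c ≡ just one
        aux (just one) _ = refl

      one-before : ∀ {w} → before w ≡ just one → w ∈ˡ xs × after w ≡ one
      one-before {w} eq with mem? Fin._≟_ w xs
      ... | yes w∈ = w∈ , cong (fromMaybe two) (trans (sym (before-final w∈)) eq)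
      ... | no  w∉ with () ← trans (sym eq) (run-untouched (const nothing) xs w∉)

    choose-one : ∀ χ v → choose H χ v ≡ one → ¬ Creates H χ v one
    choose-one χ v eq with creates? H χ v one
    ... | no ¬c = ¬c
    choose-one χ v () | yes _

    choose-two : ∀ χ v → choose H χ v ≡ two → Creates H χ v one
    choose-two χ v eq with creates? H χ v one
    ... | yes c = c
    choose-two χ v () | no _

    -- The pattern left behind by an edge `f` that is entirely of colour two. The inequalities are
    -- weak because integer birth times may coincide.
    Crossing : (Vertex H → ℕ) → Subset (order H) → Subset (order H) → Vertex H → Set
    Crossing s e f v = v ∈ e × v ∈ f × (∀ w → w ∈ e → w ∈ f → w ≡ v) ×
      (∀ w → w ∈ e → s w ℕ.≤ s v) × (∀ w → w ∈ f → s v ℕ.≤ s w)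

    module _ (s : Vertex H → ℕ) (vs : List (Vertex H)) (unique : Unique vs) (complete : ∀ v → v ∈ˡ vs)
      (sorted : AllPairs (λ v w → s v ℕ.≤ s w) vs)
      (nonempty : All Nonempty (edges H))
      (no-crossing : ∀ e f → e ∈ˡ edges H → f ∈ˡ edges H → ∀ v → ¬ Crossing s e f v)
      where

      meets : ∀ {e} → e ∈ˡ edges H → Any (_∈ e) vs
      meets e∈ = let v , v∈e = All.lookup nonempty e∈ in lose (complete v) v∈e

      -- At the turn of the last vertex of `e` the others already have colour one, so colour one
      -- would complete a monochromatic edge and is not chosen.
      not-all-one : ∀ e → e ∈ˡ edges H → ¬ (∀ v → v ∈ e → greedy H vs v ≡ one)
      not-all-one e e∈ mono with split-last (_∈? e) vs (meets e∈)
      ... | xs , v , ys , refl , v∈e , e∩ys = choose-one before v (trans (sym after-chosen) (mono v v∈e))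
        (lose e∈ (v∈e , coloured))
        where
        open At {xs} unique
        coloured : ∀ w → w ∈ e → assign H before v one w ≡ just one
        coloured w w∈e with w Fin.≟ v
        ... | yes refl = updateAt-updates v before
        ... | no w≢v = trans (updateAt-minimal w v before w≢v) (before-one w∈xs (mono w w∈e))
          where
          w∈xs : w ∈ˡ xs
          w∈xs with ∈-++⁻ xs (complete w)
          ... | inj₁ w∈xs         = w∈xs
          ... | inj₂ (here w≡v)   = ⊥-elim (w≢v w≡v)
          ... | inj₂ (there w∈ys) = ⊥-elim (All.lookup e∩ys w∈ys w∈e)

      -- The first vertex `v` of `f` got two only because some edge `e` through `v` was otherwise
      -- coloured one. The rest of `e` precedes `v`, the rest of `f` follows it: a crossing.
      not-all-two : ∀ f → f ∈ˡ edges H → ¬ (∀ v → v ∈ f → greedy H vs v ≡ two)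
      not-all-two f f∈ mono with split-first (_∈? f) vs (meets f∈)
      ... | xs , v , ys , refl , v∈f , f∩xs
        with find (choose-two (run (const nothing) xs) v (trans (sym (At.after-chosen {xs} unique)) (mono v v∈f)))
      ...   | e , e∈ , v∈e , coloured = no-crossing e f e∈ f∈ v (v∈e , v∈f , common , last , first)
        where
        open At {xs} unique
        others : ∀ w → w ∈ e → w ≢ v → w ∈ˡ xs × after w ≡ one
        others w w∈e w≢v = one-before (trans (sym (updateAt-minimal w v before w≢v)) (coloured w w∈e))
        -- Another common vertex would have colour one as part of `e` and colour two as part of `f`.
        common : ∀ w → w ∈ e → w ∈ f → w ≡ v
        common w w∈e w∈f with w Fin.≟ v
        ... | yes w≡v = w≡v
        ... | no  w≢v with () ← trans (sym (proj₂ (others w w∈e w≢v))) (mono w w∈f)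
        last : ∀ w → w ∈ e → s w ℕ.≤ s v
        last w w∈e with w Fin.≟ v
        ... | yes refl = ℕ.≤-refl
        ... | no  w≢v  = AllPairs-++ xs sorted (proj₁ (others w w∈e w≢v)) (here refl)
        first : ∀ w → w ∈ f → s v ℕ.≤ s w
        first w w∈f with ∈-++⁻ xs (complete w)
        ... | inj₁ w∈xs         = ⊥-elim (All.lookup f∩xs w∈xs w∈f)
        ... | inj₂ (here refl)  = ℕ.≤-refl
        ... | inj₂ (there w∈ys) = All.lookup (AllPairs.head (AllPairs-++ʳ xs sorted)) w∈ys

      greedy-proper : Proper H (greedy H vs)
      greedy-proper = All.tabulate λ { {e} e∈ (one , mono) → not-all-one e e∈ mono
                                     ; {e} e∈ (two , mono) → not-all-two e e∈ mono }

  -- From one order to a box of positive volume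

  position : ∀ {m} → List (Fin m) → Fin m → ℕ
  position []       v = 0
  position (x ∷ xs) v with x Fin.≟ v
  ... | yes _ = 0
  ... | no  _ = suc (position xs v)

  position≤length : ∀ {m} (xs : List (Fin m)) v → position xs v ℕ.≤ length xs
  position≤length []       v = ℕ.z≤n
  position≤length (x ∷ xs) v with x Fin.≟ v
  ... | yes _ = ℕ.z≤n
  ... | no  _ = ℕ.s≤s (position≤length xs v)

  position-increasing : ∀ {m} {xs : List (Fin m)} → Unique xs → AllPairs (λ v w → position xs v ℕ.< position xs w) xs
  position-increasing []                              = []
  position-increasing {xs = x ∷ xs} (x≢xs ∷ unique) =
    All.map head< x≢xs ∷ AllPairs-map (λ {v} {w} → tail<) x≢xs (position-increasing unique)
    where
    head< : ∀ {w} → x ≢ w → position (x ∷ xs) x ℕ.< position (x ∷ xs) w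
    head< {w} x≢w with x Fin.≟ x | x Fin.≟ w
    ... | _      | yes x≡w = ⊥-elim (x≢w x≡w)
    ... | yes _  | no _    = ℕ.s≤s ℕ.z≤n
    ... | no x≢x | no _    = ⊥-elim (x≢x refl)
    tail< : ∀ {v w} → x ≢ v → x ≢ w → position xs v ℕ.< position xs w → position (x ∷ xs) v ℕ.< position (x ∷ xs) w
    tail< {v} {w} x≢v x≢w h with x Fin.≟ v | x Fin.≟ w
    ... | yes x≡v | _       = ⊥-elim (x≢v x≡v)
    ... | no _    | yes x≡w = ⊥-elim (x≢w x≡w)
    ... | no _    | no _    = ℕ.s≤s h
    AllPairs-map : ∀ {R S : Fin _ → Fin _ → Set} {P : Fin _ → Set} →
      (∀ {v w} → P v → P w → R v w → S v w) → ∀ {ys} → All P ys → AllPairs R ys → AllPairs S ys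
    AllPairs-map f []         []       = []
    AllPairs-map f (pv ∷ pvs) (r ∷ rs) = All.zipWith (λ (pw , Rvw) → f pv pw Rvw) (pvs , r) ∷ AllPairs-map f pvs rs

  -- A rational `r` strictly between `p` and `q` separates the reals: locatedness puts `p` below
  -- `x`, which is impossible, or `r` above `x`.
  <ᴿ-separated : ∀ {x y p q} → p < q → x ≤ᴿ fromℚ p → fromℚ q ≤ᴿ y → x <ᴿ y
  <ᴿ-separated {x} {y} {p} {q} p<q x≤p q≤y = let r , p<r , r<q = <-dense p<q in
    r , [ (λ Lp → ⊥-elim (<-irrefl refl (x≤p p Lp))) , id ]′ (located x p<r) , q≤y r r<q

  product-positive : ∀ m (f : Fin m → ℚ) → (∀ v → 0ℚ < f v) → 0ℚ < Vector.foldr _*_ 1ℚ f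
  product-positive zero    f 0<f = 0<1
  product-positive (suc m) f 0<f = *-pos (0<f zero) (product-positive m (f ∘ suc) (0<f ∘ suc))

  -- The vertex at position k is born in [2k δ , (2k + 1) δ].
  module Slots {m : ℕ} (vs : List (Fin m)) where

    last : ℕ
    last = length vs ℕ.+ length vs

    -- Positions are at most `length vs`, so with this step every slot ends by time 1. The gaps of
    -- length `δ` between the closed slots make the birth times strictly ordered.
    δ : ℚ
    δ = ℤ.+ 1 / suc last

    0<δ : 0ℚ < δ
    0<δ = frac-pos 0 last

    start : Fin m → ℕ
    start v = position vs v ℕ.+ position vs v

    slots : Box m
    slots = record
      { lo    = λ v → nat (start v) * δ
      ; hi    = λ v → nat (suc (start v)) * δ
      ; 0≤lo  = λ v → *-nonneg (nat-nonneg (start v)) (<⇒≤ 0<δ)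
      ; lo≤hi = λ v → *-monoʳ-≤ (<⇒≤ 0<δ) (nat-mono (ℕ.n≤1+n (start v)))
      ; hi≤1  = λ v → subst (nat (suc (start v)) * δ ≤_) (unit-fraction last)
          (*-monoʳ-≤ (<⇒≤ 0<δ) (nat-mono (ℕ.s≤s (ℕ.+-mono-≤ (position≤length vs v) (position≤length vs v)))))
      }

    volume-positive : 0ℚ < volume slots
    volume-positive = product-positive m (λ v → hi slots v - lo slots v)
      λ v → diff-pos (*-monoʳ-< 0<δ (p<1+p (nat (start v))))
      where
      p<1+p : ∀ p → p < 1ℚ + p
      p<1+p p = subst (p <_) (+-comm p 1ℚ) (p<p+d p 0<1)

    slots-ordered : ∀ (t : BirthTimes m) → t ∈ᴮ slots → ∀ {v w} → position vs v ℕ.< position vs w → t v <ᴿ t w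
    slots-ordered t t∈ {v} {w} v<w = <ᴿ-separated {t v} {t w}
      (*-monoʳ-< 0<δ (<-≤-trans (subst (nat (suc (start v)) <_) (+-comm (nat (suc (start v))) 1ℚ) (p<p+d _ 0<1))
        (nat-mono {suc (suc (start v))} {start w} (subst (ℕ._≤ start w) (cong suc (ℕ.+-suc (position vs v) (position vs v))) (ℕ.+-mono-≤ v<w v<w)))))
      (proj₂ (t∈ v)) (proj₁ (t∈ w))

  -- One box suffices: all birth times in the slots induce the order `vs`.
  good-order⇒positive : ∀ H vs → vs ↭ allFin (order H) → Unique vs → Proper H (greedy H vs) → 0ℚ <Pr GreedyProper H
  good-order⇒positive H vs vs↭ unique proper =
    slots ∷ [] , [] ∷ [] ,
    (λ t t∈ _ → vs , (vs↭ , AllPairs.map (λ {v} {w} → slots-ordered t t∈ {v} {w}) (position-increasing unique)) , proper) ∷ [] ,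
    subst (0ℚ <_) (sym (+-identityʳ (volume slots))) volume-positive
    where open Slots vs

  -- Discretised birth times

  card-split : ∀ {m} (e f : Subset m) → card (e ∩ f) ℕ.+ card (e ∩ ∁ f) ≡ card e
  card-split []          []          = refl
  card-split (true ∷ e)  (true ∷ f)  = cong suc (card-split e f)
  card-split (true ∷ e)  (false ∷ f) = trans (ℕ.+-suc _ _) (cong suc (card-split e f))
  card-split (false ∷ e) (true ∷ f)  = card-split e f
  card-split (false ∷ e) (false ∷ f) = card-split e f

  card-positive⇒nonempty : ∀ {m} (e : Subset m) {n} → card e ≡ suc n → Nonempty e
  card-positive⇒nonempty {m} e eq with nonempty? e
  ... | yes ne = ne
  ... | no  ¬ne with () ← trans (sym eq) (trans (cong card (Empty-unique ¬ne)) (∣⊥∣≡0 m))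

  card-singleton : ∀ {m} (e f : Subset m) v → v ∈ e → v ∈ f → (∀ w → w ∈ e → w ∈ f → w ≡ v) → card (e ∩ f) ≡ 1
  card-singleton e f v v∈e v∈f only = trans (cong card e∩f≡⁅v⁆) (∣⁅x⁆∣≡1 v)
    where
    e∩f≡⁅v⁆ : e ∩ f ≡ ⁅ v ⁆
    e∩f≡⁅v⁆ = ⊆-antisym
      (λ {w} w∈ → let w∈e , w∈f = x∈p∩q⁻ e f w∈ in subst (_∈ ⁅ v ⁆) (sym (only w w∈e w∈f)) (x∈⁅x⁆ v))
      (λ w∈ → subst (_∈ e ∩ f) (sym (x∈⁅y⁆⇒x≡y v w∈)) (x∈p∩q⁺ (v∈e , v∈f)))

  -- The gap is the square of half the difference.
  am-gm : ∀ x y → x * y ≤ (x + y) * ½ * ((x + y) * ½)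
  am-gm x y = le-from-diff {d = (x - y) * ½ * ((x - y) * ½)} (square-nonneg ((x - y) * ½)) (lemma x y)
    where
    lemma : ∀ x y → (x + y) * ½ * ((x + y) * ½) ≡ x * y + (x - y) * ½ * ((x - y) * ½)
    lemma = solve 2 (λ x y → (x :+ y) :* con ½ :* ((x :+ y) :* con ½) := x :* y :+ (x :- y) :* con ½ :* ((x :- y) :* con ½)) refl

  -- Edges have `suc n` vertices. Of the `K` times the first `a` form the left part, the next `c`
  -- the middle and the last `a` the right. `β` replaces the bound 1/4 on t(1-t), since in discrete
  -- time both edges may use the time `i` itself.
  module Discretised (H : Hypergraph) (n : ℕ) (uniform : Uniform (suc n) H)
    (K a c : ℕ) (K≡ : K ≡ a ℕ.+ (c ℕ.+ a)) (ε : ℚ) (Kε≡1 : nat K * ε ≡ 1ℚ) (0<ε : 0ℚ < ε) where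

    α β : ℚ
    α = nat a * ε
    β = (1ℚ + ε) * ½ * ((1ℚ + ε) * ½)

    open Uniform-measure K ε Kε≡1 0<ε

    0≤ε : 0ℚ ≤ ε
    0≤ε = <⇒≤ 0<ε

    -- The common vertex has one admissible time, and each edge has `n` further vertices. Their
    -- sides have at most `suc i` and `K ∸ i` times, of measures summing to `1ℚ + ε`, so `am-gm`
    -- bounds the product of the two sides by `β`.
    crossing≤ : ∀ (e f : Subset (order H)) → card e ≡ suc n → card f ≡ suc n → card (e ∩ f) ≡ 1 → ∀ {i} → i ℕ.< K →
                measure (crossing e f i) ≤ ε * β ^ n
    crossing≤ e f ∣e∣ ∣f∣ ∣e∩f∣ {i} i<K = subst (_≤ ε * β ^ n) (sym μ≡)
      (*-mono-≤ (side-nonneg (_≡ᵇ i)) (^-nonneg n (square-nonneg ((1ℚ + ε) * ½)))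
        (subst (#< K (_≡ᵇ i) * ε ≤_) (*-identityˡ ε) (*-monoʳ-≤ 0≤ε (#-≡ K i)))
        (^-mono n (*-nonneg (side-nonneg (_≤ᵇ i)) (side-nonneg (i ≤ᵇ_)))
          (≤-trans (*-mono-≤ (side-nonneg (_≤ᵇ i)) (*-nonneg (nat-nonneg (K ∸ i)) 0≤ε)
              (*-monoʳ-≤ 0≤ε (#-≤ K i)) (*-monoʳ-≤ 0≤ε (#-≥ K i)))
            (subst (λ p → nat (suc i) * ε * (nat (K ∸ i) * ε) ≤ p * ½ * (p * ½)) sum≡ (am-gm (nat (suc i) * ε) (nat (K ∸ i) * ε))))))
      where
      difference : ∀ e f → card e ≡ suc n → card (e ∩ f) ≡ 1 → card (e ∩ ∁ f) ≡ n
      difference e f ∣e∣ ∣e∩f∣ = ℕ.suc-injective (trans (cong (ℕ._+ card (e ∩ ∁ f)) (sym ∣e∩f∣)) (trans (card-split e f) ∣e∣))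
      A C : ℚ
      A = #< K (_≤ᵇ i) * ε
      C = #< K (i ≤ᵇ_) * ε
      μ≡ : measure (crossing e f i) ≡ #< K (_≡ᵇ i) * ε * (A * C) ^ n
      μ≡ = begin
        measure (crossing e f i)                                   ≡⟨ measure-crossing e f i ⟩
        B ^ card (e ∩ f) * A ^ card (e ∩ ∁ f) * C ^ card (f ∩ ∁ e)  ≡⟨ cong₂ _*_ (cong₂ _*_ (cong (B ^_) ∣e∩f∣)
          (cong (A ^_) (difference e f ∣e∣ ∣e∩f∣))) (cong (C ^_) (difference f e ∣f∣ (trans (cong card (∩-comm f e)) ∣e∩f∣))) ⟩
        B * 1ℚ * A ^ n * C ^ n                                      ≡⟨ cong (λ b → b * A ^ n * C ^ n) (*-identityʳ B) ⟩
        B * A ^ n * C ^ n                                           ≡⟨ *-assoc B (A ^ n) (C ^ n) ⟩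
        B * (A ^ n * C ^ n)                                         ≡⟨ cong (B *_) (sym (^-distrib-* A C n)) ⟩
        B * (A * C) ^ n                                             ∎
        where
        open ≡-Reasoning
        B : ℚ
        B = #< K (_≡ᵇ i) * ε
      sum≡ : nat (suc i) * ε + nat (K ∸ i) * ε ≡ 1ℚ + ε
      sum≡ = trans (sym (*-distribʳ-+ ε (nat (suc i)) (nat (K ∸ i))))
        (trans (cong (_* ε) (trans (sym (nat-+ (suc i) (K ∸ i))) (cong (λ j → nat (suc j)) (ℕ.m+[n∸m]≡n (ℕ.<⇒≤ i<K)))))
          (trans (suc-mult K ε) (trans (+-comm ε (nat K * ε)) (cong (_+ ε) Kε≡1))))

    -- A crossing forces exactly one common vertex, so other pairs contribute nothing; the remaining
    -- ones have a rectangle for each middle time.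
    pairRectangles : Subset (order H) → Subset (order H) → List (Rectangle (order H))
    pairRectangles e f with card (e ∩ f) ℕ.≟ 1
    ... | yes _ = concatMap (λ j → crossing e f (a ℕ.+ j) ∷ []) (upTo c)
    ... | no  _ = []

    edgeRectangles : Subset (order H) → List (Rectangle (order H))
    edgeRectangles e = within (_<ᵇ a) e ∷ within (a ℕ.+ c ≤ᵇ_) e ∷ concatMap (pairRectangles e) (edges H)

    rectangles : List (Rectangle (order H))
    rectangles = concatMap edgeRectangles (edges H)

    middle : ∀ {j} → j ℕ.< c → a ℕ.+ j ℕ.< K
    middle {j} j<c = subst (a ℕ.+ j ℕ.<_) (sym K≡) (ℕ.+-monoʳ-< a (ℕ.<-≤-trans j<c (ℕ.m≤m+n c a)))

    pairRectangles≤ : ∀ e f → card e ≡ suc n → card f ≡ suc n → total (pairRectangles e f) ≤ nat c * (ε * β ^ n)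
    pairRectangles≤ e f ∣e∣ ∣f∣ with card (e ∩ f) ℕ.≟ 1
    ... | yes ∣e∩f∣ = subst (λ l → total (concatMap g (upTo c)) ≤ nat l * (ε * β ^ n)) (length-upTo c)
            (total-concatMap g (upTo c) (All.tabulate λ {j} j∈ →
              subst (_≤ ε * β ^ n) (sym (+-identityʳ (measure (crossing e f (a ℕ.+ j))))) (crossing≤ e f ∣e∣ ∣f∣ ∣e∩f∣ (middle (∈-upTo⁻ j∈)))))
      where
      g : ℕ → List (Rectangle (order H))
      g j = crossing e f (a ℕ.+ j) ∷ []
    ... | no _ = *-nonneg (nat-nonneg c) (*-nonneg 0≤ε (^-nonneg n (square-nonneg ((1ℚ + ε) * ½))))

    within≤ : ∀ (e : Subset (order H)) b → card e ≡ suc n → #< K b ≤ nat a → measure (within b e) ≤ α ^ suc n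
    within≤ e b ∣e∣ #b≤a = subst (_≤ α ^ suc n) (sym (trans (measure-within b e) (cong ((#< K b * ε) ^_) ∣e∣)))
      (^-mono (suc n) (side-nonneg b) (*-monoʳ-≤ 0≤ε #b≤a))

    K∸[a+c]≡a : K ∸ (a ℕ.+ c) ≡ a
    K∸[a+c]≡a = trans (cong (_∸ (a ℕ.+ c)) (trans K≡ (sym (ℕ.+-assoc a c a)))) (ℕ.m+n∸m≡n (a ℕ.+ c) a)

    rectangles≤ : total rectangles ≤ nat (#edges H) * (α ^ suc n + (α ^ suc n + nat (#edges H) * (nat c * (ε * β ^ n))))
    rectangles≤ = total-concatMap edgeRectangles (edges H) (All.map (λ {e} ∣e∣ →
      +-mono-≤ (within≤ e (_<ᵇ a) ∣e∣ (#-< K a))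
        (+-mono-≤ (within≤ e (a ℕ.+ c ≤ᵇ_) ∣e∣ (subst (λ j → #< K (a ℕ.+ c ≤ᵇ_) ≤ nat j) K∸[a+c]≡a (#-≥ K (a ℕ.+ c))))
          (total-concatMap (pairRectangles e) (edges H) (All.map (λ {f} ∣f∣ → pairRectangles≤ e f ∣e∣ ∣f∣) uniform)))) uniform)

    ¬avoids : ∀ s (R : Rectangle (order H)) → (∀ v → T (R v (s v))) → ¬ Avoids s R
    ¬avoids s R h (v , eq) = subst T eq (h v)

    within-holds : ∀ (b : ℕ → Bool) (e : Subset (order H)) {s : Vertex H → ℕ} → (∀ v → v ∈ e → T (b (s v))) → ∀ v → T (within b e v (s v))
    within-holds b e h v with lookup e v in eq
    ... | true  = h v (lookup⇒[]= v e eq)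
    ... | false = _

    crossing-holds : ∀ {e f : Subset (order H)} {s : Vertex H → ℕ} {i} →
      (∀ w → w ∈ e → w ∈ f → s w ≡ i) → (∀ w → w ∈ e → s w ℕ.≤ i) → (∀ w → w ∈ f → i ℕ.≤ s w) →
      ∀ w → T (crossing e f i w (s w))
    crossing-holds {e} {f} {s} {i} both left right w with lookup e w in w∈e | lookup f w in w∈f
    ... | true  | true  = ℕ.≡⇒≡ᵇ (s w) i (both w (lookup⇒[]= w e w∈e) (lookup⇒[]= w f w∈f))
    ... | true  | false = ℕ.≤⇒≤ᵇ (left w (lookup⇒[]= w e w∈e))
    ... | false | true  = ℕ.≤⇒≤ᵇ (right w (lookup⇒[]= w f w∈f))
    ... | false | false = _

    module _ (s : Vertex H → ℕ) (s<K : ∀ v → s v ℕ.< K) (avoids : All (Avoids s) rectangles) where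

      edge-avoids : ∀ {e} → e ∈ˡ edges H → ∀ {R} → R ∈ˡ edgeRectangles e → Avoids s R
      edge-avoids e∈ R∈ = All.lookup avoids (∈-concatMap⁺ edgeRectangles (lose e∈ R∈))

      pair-avoids : ∀ {e f} → e ∈ˡ edges H → f ∈ˡ edges H → card (e ∩ f) ≡ 1 → ∀ {j} → j ℕ.< c → Avoids s (crossing e f (a ℕ.+ j))
      pair-avoids {e} {f} e∈ f∈ ∣e∩f∣ {j} j<c =
        edge-avoids e∈ (there (there (∈-concatMap⁺ (pairRectangles e) (lose f∈ pair∈))))
        where
        pair∈ : crossing e f (a ℕ.+ j) ∈ˡ pairRectangles e f
        pair∈ with card (e ∩ f) ℕ.≟ 1
        ... | yes _ = ∈-concatMap⁺ (λ j → crossing e f (a ℕ.+ j) ∷ []) (lose (∈-upTo⁺ j<c) (here refl))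
        ... | no ¬1 = ⊥-elim (¬1 ∣e∩f∣)

      -- The time of `v` decides which rectangle is hit: in the left part it takes all of `e` along,
      -- in the right part all of `f`, and in the middle the pair hits the crossing rectangle of
      -- that time.
      no-crossing : ∀ e f → e ∈ˡ edges H → f ∈ˡ edges H → ∀ v → ¬ Greedy.Crossing H s e f v
      no-crossing e f e∈ f∈ v (v∈e , v∈f , only , last , first) with s v ℕ.<? a
      ... | yes sv<a = ¬avoids s (within (_<ᵇ a) e) (within-holds (_<ᵇ a) e λ w w∈e → ℕ.<⇒<ᵇ (ℕ.≤-<-trans (last w w∈e) sv<a))
              (edge-avoids e∈ (here refl))
      ... | no sv≮a with a ℕ.+ c ℕ.≤? s v
      ...   | yes a+c≤sv = ¬avoids s (within (a ℕ.+ c ≤ᵇ_) f)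
              (within-holds (a ℕ.+ c ≤ᵇ_) f λ w w∈f → ℕ.≤⇒≤ᵇ (ℕ.≤-trans a+c≤sv (first w w∈f)))
              (edge-avoids f∈ (there (here refl)))
      ...   | no a+c≰sv = ¬avoids s (crossing e f (a ℕ.+ (s v ∸ a))) (crossing-holds {e} {f} (λ w w∈e w∈f → trans (cong s (only w w∈e w∈f)) sv≡)
                (λ w w∈e → subst (s w ℕ.≤_) sv≡ (last w w∈e)) (λ w w∈f → subst (ℕ._≤ s w) sv≡ (first w w∈f)))
                (pair-avoids e∈ f∈ (card-singleton e f v v∈e v∈f only) j<c)
        where
        sv≡ : s v ≡ a ℕ.+ (s v ∸ a)
        sv≡ = sym (ℕ.m+[n∸m]≡n (ℕ.≮⇒≥ sv≮a))
        j<c : s v ∸ a ℕ.< c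
        j<c = ℕ.+-cancelˡ-< a (s v ∸ a) c (subst (ℕ._< a ℕ.+ c) sv≡ (ℕ.≰⇒> a+c≰sv))

      -- Sorting breaks ties arbitrarily; `greedy-proper` asks only for a weakly increasing order.
      open Sort (On.decTotalOrder ℕ.≤-decTotalOrder s) using (sort; sort-↭; sort-↗)

      positive-probability : 0ℚ <Pr GreedyProper H
      positive-probability = good-order⇒positive H vs (sort-↭ (allFin (order H))) unique
        (Greedy.greedy-proper H s vs unique (λ v → ∈-resp-↭ (↭-sym (sort-↭ (allFin (order H)))) (∈-allFin v))
          (Sorted⇒AllPairs (On.totalOrder ℕ.≤-totalOrder s) (sort-↗ (allFin (order H))))
          (All.map (λ {e} → card-positive⇒nonempty e) uniform) no-crossing)
        where
        vs : List (Vertex H)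
        vs = sort (allFin (order H))
        unique : Unique vs
        unique = Unique-resp-↭ (setoid (Vertex H)) (↭⇒↭ₛ (↭-sym (sort-↭ (allFin (order H))))) (allFin⁺ (order H))

    small⇒positive : nat (#edges H) * (α ^ suc n + (α ^ suc n + nat (#edges H) * (nat c * (ε * β ^ n)))) < 1ℚ → 0ℚ <Pr GreedyProper H
    small⇒positive h = let s , s<K , avoids = union-bound rectangles (≤-<-trans rectangles≤ h) in positive-probability s s<K avoids

  -- Analytic estimates

  -- (1 - y)(1 + (N + 1) y) = 1 + N y - (N + 1) y²; y may be negative.
  bernoulli : ∀ y N → y ≤ 1ℚ → (1ℚ - y) ^ N * (1ℚ + nat N * y) ≤ 1ℚ
  bernoulli y zero    y≤1 = ≤-reflexive (lemma y)
    where
    lemma : ∀ y → 1ℚ * (1ℚ + 0ℚ * y) ≡ 1ℚ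
    lemma = solve 1 (λ y → con 1ℚ :* (con 1ℚ :+ con 0ℚ :* y) := con 1ℚ) refl
  bernoulli y (suc N) y≤1 = ≤-trans
    (subst (_≤ (1ℚ - y) ^ N * (1ℚ + nat N * y)) (sym (assoc (1ℚ - y) ((1ℚ - y) ^ N) (1ℚ + nat (suc N) * y)))
      (*-monoˡ-≤ (^-nonneg N (diff-nonneg y≤1)) (le-from-diff (*-nonneg (nat-nonneg (suc N)) (square-nonneg y)) (lemma y (nat N)))))
    (bernoulli y N y≤1)
    where
    assoc : ∀ a b c → a * b * c ≡ b * (a * c)
    assoc = solve 3 (λ a b c → a :* b :* c := b :* (a :* c)) refl
    lemma : ∀ y n → 1ℚ + n * y ≡ (1ℚ - y) * (1ℚ + (1ℚ + n) * y) + (1ℚ + n) * (y * y)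
    lemma = solve 2 (λ y n → con 1ℚ :+ n :* y :=
      (con 1ℚ :- y) :* (con 1ℚ :+ (con 1ℚ :+ n) :* y) :+ (con 1ℚ :+ n) :* (y :* y)) refl

  -- e^{-h} ≤ (a+1)/(a+m+1) for h = 1/(a+1) + ⋯ + 1/(a+m), with (1 - h/N)^N in place of e^{-h}
  power-harmonic : ∀ N ν → 0ℚ ≤ ν → nat N * ν ≡ 1ℚ → ∀ a m → harmonic a m * ν ≤ 1ℚ →
                   (1ℚ - harmonic a m * ν) ^ N * nat (suc (a ℕ.+ m)) ≤ nat (suc a)
  power-harmonic N ν 0≤ν Nν≡1 a zero h = ≤-reflexive (trans
    (cong₂ _*_ (trans (cong (_^ N) (lemma ν)) (one^ N)) (cong (λ b → nat (suc b)) (ℕ.+-identityʳ a)))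
    (*-identityˡ (nat (suc a))))
    where
    lemma : ∀ ν → 1ℚ - 0ℚ * ν ≡ 1ℚ
    lemma = solve 1 (λ ν → con 1ℚ :- con 0ℚ :* ν := con 1ℚ) refl
    one^ : ∀ N → 1ℚ ^ N ≡ 1ℚ
    one^ zero    = refl
    one^ (suc N) = trans (*-identityˡ (1ℚ ^ N)) (one^ N)
  power-harmonic N ν 0≤ν Nν≡1 a (suc m) h≤1 = begin
    -- Splitting off the first harmonic term costs only the nonnegative product `x * ν * (y * ν)`.
    (1ℚ - (x + y) * ν) ^ N * nat (suc (a ℕ.+ suc m))         ≤⟨ *-mono-≤ (^-nonneg N (diff-nonneg h≤1)) (nat-nonneg (suc (suc a ℕ.+ m)))
        (^-mono N (diff-nonneg h≤1) (le-from-diff (*-nonneg (*-nonneg 0≤x 0≤ν) (*-nonneg 0≤y 0≤ν)) (split x y ν)))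
        (≤-reflexive (cong (λ b → nat (suc b)) (ℕ.+-suc a m))) ⟩
    ((1ℚ - x * ν) * (1ℚ - y * ν)) ^ N * k                    ≡⟨ cong (_* k) (^-distrib-* (1ℚ - x * ν) (1ℚ - y * ν) N) ⟩
    (1ℚ - x * ν) ^ N * (1ℚ - y * ν) ^ N * k                  ≡⟨ *-assoc ((1ℚ - x * ν) ^ N) ((1ℚ - y * ν) ^ N) k ⟩
    (1ℚ - x * ν) ^ N * ((1ℚ - y * ν) ^ N * k)                ≤⟨ *-monoˡ-≤ (^-nonneg N (diff-nonneg xν≤1))
        (power-harmonic N ν 0≤ν Nν≡1 (suc a) m yν≤1) ⟩
    -- As `nat N * ν` is 1, the Bernoulli factor is 1 + 1/(a+1), which takes a+1 to a+2.
    (1ℚ - x * ν) ^ N * nat (suc (suc a))                     ≡⟨ cong ((1ℚ - x * ν) ^ N *_) next ⟩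
    (1ℚ - x * ν) ^ N * ((1ℚ + nat N * (x * ν)) * nat (suc a)) ≡⟨ sym (*-assoc ((1ℚ - x * ν) ^ N) (1ℚ + nat N * (x * ν)) (nat (suc a))) ⟩
    (1ℚ - x * ν) ^ N * (1ℚ + nat N * (x * ν)) * nat (suc a)   ≤⟨ *-monoʳ-≤ (nat-nonneg (suc a)) (bernoulli (x * ν) N xν≤1) ⟩
    1ℚ * nat (suc a)                                         ≡⟨ *-identityˡ (nat (suc a)) ⟩
    nat (suc a)                                              ∎
    where
    open ≤-Reasoning
    x y k : ℚ
    x = ℤ.+ 1 / suc a
    y = harmonic (suc a) m
    k = nat (suc (suc a ℕ.+ m))
    0≤x : 0ℚ ≤ x
    0≤x = <⇒≤ (frac-pos 0 a)
    0≤y : 0ℚ ≤ y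
    0≤y = harmonic-nonneg (suc a) m
    xν≤1 : x * ν ≤ 1ℚ
    xν≤1 = ≤-trans (*-monoʳ-≤ 0≤ν (p≤p+d x 0≤y)) h≤1
    yν≤1 : y * ν ≤ 1ℚ
    yν≤1 = ≤-trans (*-monoʳ-≤ 0≤ν (subst (y ≤_) (+-comm y x) (p≤p+d y 0≤x))) h≤1
    split : ∀ x y ν → (1ℚ - x * ν) * (1ℚ - y * ν) ≡ 1ℚ - (x + y) * ν + x * ν * (y * ν)
    split = solve 3 (λ x y ν → (con 1ℚ :- x :* ν) :* (con 1ℚ :- y :* ν) := con 1ℚ :- (x :+ y) :* ν :+ x :* ν :* (y :* ν)) refl
    next : nat (suc (suc a)) ≡ (1ℚ + nat N * (x * ν)) * nat (suc a)
    next = trans (cong (_+ nat (suc a)) (trans (sym (unit-fraction a)) (sym (trans (cong (nat (suc a) * x *_) Nν≡1) (*-identityʳ _)))))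
      (lemma (nat N) x ν (nat (suc a)))
      where
      lemma : ∀ N x ν s → s * x * (N * ν) + s ≡ (1ℚ + N * (x * ν)) * s
      lemma = solve 4 (λ N x ν s → s :* x :* (N :* ν) :+ s := (con 1ℚ :+ N :* (x :* ν)) :* s) refl

  harmonic-mono : ∀ a {M N} → M ℕ.≤ N → harmonic a M ≤ harmonic a N
  harmonic-mono a {M} {N} M≤N = subst (λ N → harmonic a M ≤ harmonic a N) (ℕ.m+[n∸m]≡n M≤N)
    (subst (harmonic a M ≤_) (sym (harmonic-++ a M (N ∸ M))) (p≤p+d (harmonic a M) (harmonic-nonneg (a ℕ.+ M) (N ∸ M))))

  -- Oresme's argument: the `suc M` terms after 1/(M+1) are all at least 1/(2M+2), so together they
  -- add at least 1/2.
  harmonic-halves : ∀ k → ∃ λ M → nat k * ½ ≤ harmonic 1 M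
  harmonic-halves zero    = 0 , ≤-reflexive (*-zeroˡ ½)
  harmonic-halves (suc k) = let M , h = harmonic-halves k in M ℕ.+ suc M ,
    subst₂ _≤_ (sym (trans (suc-mult k ½) (+-comm ½ (nat k * ½)))) (sym (harmonic-++ 1 M (suc M)))
      (+-mono-≤ h (subst (_≤ harmonic (suc M) (suc M)) (block-unit 1 M)
        (block-lower (suc M) (suc M) (M ℕ.+ 1 ℕ.* suc M) (ℕ.≤-reflexive (cong (λ j → suc (M ℕ.+ j)) (sym (ℕ.*-identityˡ (suc M))))))))

  harmonic-unbounded : ∀ B → ∃ λ M → ∀ m → M ℕ.≤ m → B < harmonic 1 m
  harmonic-unbounded B =
    let k , 2B≤k = below-nat (B * 2ℚ)
        M , h    = harmonic-halves (suc k)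
    in M , λ m M≤m → <-≤-trans (<-≤-trans (B<[1+k]½ k 2B≤k) h) (harmonic-mono 1 M≤m)
    where
    lemma : ∀ B → B * 2ℚ * ½ ≡ B
    lemma = solve 1 (λ B → B :* con 2ℚ :* con ½ := B) refl
    B<[1+k]½ : ∀ k → B * 2ℚ ≤ nat k → B < nat (suc k) * ½
    B<[1+k]½ k 2B≤k = subst (_< nat (suc k) * ½) (lemma B)
      (*-monoʳ-< (positive⁻¹ ½) (≤-<-trans 2B≤k (subst (nat k <_) (+-comm (nat k) 1ℚ) (p<p+d (nat k) 0<1))))

  -- Lower bounds in real arithmetic

  -- In an enclosure witnessing `r` below the product, the corner `b * c` exceeds `r` ≥ 0 while `b`
  -- is positive, so `c` is positive. Then the corner `a * c` gives the bound, with `c` as the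
  -- witness `s`.
  L-factor : ∀ x y {r k} → L x 0ℚ → (∀ {a} → L x a → a ≤ k) → 0ℚ ≤ r → L (x *ᴿ y) r →
             ∃ λ s → 0ℚ < s × L y s × r < k * s
  L-factor x y {r} {k} 0<x x≤k 0≤r (R , r<ac , _ , r<bc , _) =
    R.c , 0<c , R.c<y , <-≤-trans r<ac (*-monoʳ-≤ (<⇒≤ 0<c) (x≤k R.a<x))
    where
    module R = Enclosure R
    0<b : 0ℚ < R.b
    0<b = L<U x 0<x R.x<b
    0<c : 0ℚ < R.c
    0<c = ≰⇒> λ c≤0 → <-irrefl refl (<-≤-trans r<bc (≤-trans
      (subst (R.b * R.c ≤_) (*-zeroʳ R.b) (*-monoˡ-≤ (<⇒≤ 0<b) c≤0)) 0≤r))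

  L-comm : ∀ x y {r} → L (x *ᴿ y) r → L (y *ᴿ x) r
  L-comm x y {r} (R , ac , ad , bc , bd) =
    record { a = R.c ; b = R.d ; c = R.a ; d = R.b ; a<x = R.c<y ; x<b = R.y<d ; c<y = R.a<x ; y<d = R.x<b } ,
    swap R.a R.c ac , swap R.b R.c bc , swap R.a R.d ad , swap R.b R.d bd
    where
    module R = Enclosure R
    swap : ∀ p s → r < p * s → r < s * p
    swap p s = subst (r <_) (*-comm p s)

  -- A cut supplies only rationals strictly below `N`. If the bound failed at `N`, approximating a
  -- square root from below would give such an `r` with `r * r * l` at least `B`.
  square-bound : ∀ {N l B} → 0ℚ < N → 0ℚ < l → (∀ {r} → 0ℚ < r → r < N → r * r * l < B) → N * N * l ≤ B
  square-bound {N} {l} {B} 0<N 0<l h = ≮⇒≥ λ B<N²l → go B<N²l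
    where
    go : ¬ (B < N * N * l)
    go B<N²l =
      let s , s<N² , B≤sl      = quotient-below 0<l B<N²l
          r , 0<r , r<N , s≤r² = square-below 0<N s<N²
      in <-irrefl refl (<-≤-trans (h 0<r r<N) (≤-trans B≤sl (*-monoʳ-≤ (<⇒≤ 0<l) s≤r²)))

  nat-positive : ∀ n → 0ℚ < nat (suc n)
  nat-positive n = <-≤-trans 0<1 (p≤p+d 1ℚ (nat-nonneg n))

  below-fromℕ : ∀ {n p} → p < nat n → L (fromℕ n) p
  below-fromℕ {n} = subst (_ <_) (sym (frac-one n))

  fromℕ-below : ∀ {n p} → L (fromℕ n) p → p ≤ nat n
  fromℕ-below {n} p<n = <⇒≤ (subst (_ <_) (frac-one n) p<n)

  L-product : ∀ x y t {r q k} → L x 0ℚ → (∀ {a} → L x a → a ≤ q) → L t 0ℚ → (∀ {a} → L t a → a ≤ k) →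
              0ℚ ≤ r → L (x *ᴿ y *ᴿ t) r → ∃ λ s → ∃ λ z → 0ℚ < s × 0ℚ < z × L y z × r < k * s × s < q * z
  L-product x y t {r} {q} {k} 0<x x≤q 0<t t≤k 0≤r Lr = outer (L-factor t (x *ᴿ y) {r} {k} 0<t t≤k 0≤r (L-comm (x *ᴿ y) t {r} Lr))
    where
    outer : (∃ λ s → 0ℚ < s × L (x *ᴿ y) s × r < k * s) → _
    outer (s , 0<s , Ls , r<ks) with L-factor x y {s} {q} 0<x x≤q (<⇒≤ 0<s) Ls
    ... | z , 0<z , Lz , s<qz = s , z , 0<s , 0<z , Lz , r<ks , s<qz

  -- The cut of the inverse supplies a rational `u` above `ln n`, hence above every lower sum. Its
  -- positivity is left to the caller, who knows that the lower sum is positive.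
  L-quotient : ∀ n (1<n : 1 ℕ.< n) {r} → 0ℚ ≤ r → L (fromℕ n *ᴿ inverse (ln n) (ln-positive 1<n)) r →
               ∃ λ u → lowerSum n 0 ≤ u × (0ℚ < u → r * u < nat n)
  L-quotient n 1<n {r} 0≤r Lr = from-factor
    (L-factor (fromℕ n) (inverse (ln n) (ln-positive 1<n)) {r} {nat n} (below-fromℕ {n} 0<n) (λ {a} → fromℕ-below {n} {a}) 0≤r Lr)
    where
    0<n : 0ℚ < nat n
    0<n = <-≤-trans (nat-positive 0) (nat-mono (ℕ.<⇒≤ 1<n))
    from-factor : (∃ λ w → 0ℚ < w × L (inverse (ln n) (ln-positive 1<n)) w × r < nat n * w) →
                  ∃ λ u → lowerSum n 0 ≤ u × (0ℚ < u → r * u < nat n)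
    from-factor (w , 0<w , (u , (j , upper<u) , wu<1) , r<nw) = u , ≤-trans (lower≤upper n 0 j) (<⇒≤ upper<u) , λ 0<u →
      <-trans (*-monoʳ-< 0<u r<nw) (subst₂ _<_ (sym (*-assoc (nat n) w u)) (*-identityʳ (nat n)) (*-monoˡ-< 0<n wu<1))

  -- Squaring removes the root. A rational r with 0 < r < N satisfies r < T s, s < q z and z² u < B
  -- for some u ≥ l, whence r² l < T² q² B; `square-bound` then passes to N.
  square-bound-√ : ∀ c q Z (B : ℚ) l N T → L c 0ℚ → (∀ {a} → L c a → a ≤ q) → 0ℚ < q → 0ℚ < nat T → 0ℚ < l → 0ℚ ≤ B →
    (∀ {r} → 0ℚ ≤ r → L Z r → ∃ λ u → l ≤ u × (0ℚ < u → r * u < B)) →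
    fromℕ N ≤ᴿ c *ᴿ √ Z *ᴿ fromℕ T → nat N * nat N * l ≤ nat T * nat T * (q * q * B)
  square-bound-√ c q Z B l zero    T 0<c c≤q 0<q 0<T 0<l 0≤B hZ h =
    subst (_≤ nat T * nat T * (q * q * B)) (sym (trans (cong (_* l) (*-zeroˡ 0ℚ)) (*-zeroˡ l)))
      (*-nonneg (square-nonneg (nat T)) (*-nonneg (square-nonneg q) 0≤B))
  square-bound-√ c q Z B l (suc N) T 0<c c≤q 0<q 0<T 0<l 0≤B hZ h = square-bound (nat-positive N) 0<l below
    where
    combine : ∀ {r s z u} → 0ℚ < r → r < nat T * s → s < q * z → l ≤ u → z * z * u < B →
              r * r * l < nat T * nat T * (q * q * B)
    combine {r} {s} {z} {u} 0<r r<Ts s<qz l≤u z²u<B = begin-strict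
      r * r * l                                 ≤⟨ *-monoˡ-≤ (square-nonneg r) l≤u ⟩
      r * r * u                                 <⟨ *-monoʳ-< (<-≤-trans 0<l l≤u) (square-< (<⇒≤ 0<r) (<-trans r<Ts (*-monoˡ-< 0<T s<qz))) ⟩
      nat T * (q * z) * (nat T * (q * z)) * u   ≡⟨ lemma (nat T) q z u ⟩
      nat T * nat T * (q * q * (z * z * u))     <⟨ *-monoˡ-< (*-pos 0<T 0<T) (*-monoˡ-< (*-pos 0<q 0<q) z²u<B) ⟩
      nat T * nat T * (q * q * B)               ∎
      where
      open ≤-Reasoning
      lemma : ∀ T q z u → T * (q * z) * (T * (q * z)) * u ≡ T * T * (q * q * (z * z * u))
      lemma = solve 4 (λ T q z u → T :* (q :* z) :* (T :* (q :* z)) :* u := T :* T :* (q :* q :* (z :* z :* u))) refl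

    from-product : ∀ {r} → 0ℚ < r → (∃ λ s → ∃ λ z → 0ℚ < s × 0ℚ < z × L (√ Z) z × r < nat T * s × s < q * z) →
                   r * r * l < nat T * nat T * (q * q * B)
    -- The lower cut of a root contains all negative rationals; positivity of `z` excludes that
    -- case.
    from-product 0<r (s , z , 0<s , 0<z , inj₁ z<0 , r<Ts , s<qz) = ⊥-elim (<-asym 0<z z<0)
    from-product 0<r (s , z , 0<s , 0<z , inj₂ Lz  , r<Ts , s<qz) =
      let u , l≤u , z²u<B = hZ (square-nonneg z) Lz in combine 0<r r<Ts s<qz l≤u (z²u<B (<-≤-trans 0<l l≤u))

    below : ∀ {r} → 0ℚ < r → r < nat (suc N) → r * r * l < nat T * nat T * (q * q * B)
    below {r} 0<r r<N = from-product 0<r (L-product c (√ Z) (fromℕ T) {r} {q} {nat T} 0<c c≤q (below-fromℕ {T} 0<T)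
      (λ {a} → fromℕ-below {T} {a}) (<⇒≤ 0<r) (h r (below-fromℕ {suc N} r<N)))

  edges-bound : ∀ c q n N T (1<n : 1 ℕ.< n) → L c 0ℚ → (∀ {a} → L c a → a ≤ q) → 0ℚ < q → 0ℚ < nat T → 0ℚ < lowerSum n 0 →
    fromℕ N ≤ᴿ c *ᴿ √ (fromℕ n *ᴿ inverse (ln n) (ln-positive 1<n)) *ᴿ fromℕ T →
    nat N * nat N * lowerSum n 0 ≤ nat T * nat T * (q * q * nat n)
  edges-bound c q n N T 1<n 0<c c≤q 0<q 0<T 0<l h =
    square-bound-√ c q (fromℕ n *ᴿ inverse (ln n) (ln-positive 1<n)) (nat n) (lowerSum n 0) N T 0<c c≤q 0<q 0<T 0<l (nat-nonneg n)
      (λ {r} → L-quotient n 1<n {r}) h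

  -- Choice of the parameters

  as-fraction : ∀ p → 0ℚ ≤ p → ∃ λ P → ∃ λ d → p ≡ nat P * (ℤ.+ 1 / suc d)
  as-fraction p@(mkℚ (ℤ.+ P) d _)    0≤p = P , d , trans (sym (↥p/↧p≡p p)) (nat-scale P d)
  as-fraction p@(mkℚ ℤ.-[1+ _ ] d _) 0≤p = ⊥-elim (<-irrefl refl (<-≤-trans (negative⁻¹ p) 0≤p))

  -- Equal steps of length `ε` that cut [0,1] exactly into a middle part of length `p` and two equal
  -- outer parts, so that rounding affects only the crossing bound.
  record Grid (p ε₀ : ℚ) : Set where
    field
      outer inner : ℕ
      ε           : ℚ
      total≡1     : nat (outer ℕ.+ (inner ℕ.+ outer)) * ε ≡ 1ℚ
      0<ε         : 0ℚ < ε
      ε≤ε₀        : ε ≤ ε₀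
      outer≡      : nat outer * ε ≡ (1ℚ - p) * ½
      inner≡      : nat inner * ε ≡ p

  -- For p = P/D the step 1/(2DM) works: the middle gets 2PM steps, each outer part (D-P)M, and a
  -- large M makes the step small. As p ≤ 1, the subtraction is not truncated.
  grid : ∀ p ε₀ → 0ℚ ≤ p → p ≤ 1ℚ → 0ℚ < ε₀ → Grid p ε₀
  grid p ε₀ 0≤p p≤1 0<ε₀ =
    let P , d , p≡ = as-fraction p 0≤p
        j , μ<ε₀   = small-unit-fraction ε₀ 0<ε₀
    in build P d (ℤ.+ 1 / suc d) (unit-fraction d) (frac-pos 0 d) (unit-anti {0} {d} ℕ.z≤n) p≡
         (suc j) (ℤ.+ 1 / suc j) (unit-fraction j) (frac-pos 0 j) μ<ε₀
    where
    build : ∀ P d δ → nat (suc d) * δ ≡ 1ℚ → 0ℚ < δ → δ ≤ 1ℚ → p ≡ nat P * δ →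
            ∀ M μ → nat M * μ ≡ 1ℚ → 0ℚ < μ → μ < ε₀ → Grid p ε₀
    build P d δ Dδ≡1 0<δ δ≤1 p≡ M μ Mμ≡1 0<μ μ<ε₀ = record
      { outer   = Q ℕ.* M
      ; inner   = (P ℕ.+ P) ℕ.* M
      ; ε       = δ * μ * ½
      ; total≡1 = begin
          nat (Q ℕ.* M ℕ.+ ((P ℕ.+ P) ℕ.* M ℕ.+ Q ℕ.* M)) * (δ * μ * ½)     ≡⟨ cong (_* (δ * μ * ½))
            (trans (nat-+ (Q ℕ.* M) ((P ℕ.+ P) ℕ.* M ℕ.+ Q ℕ.* M))
              (cong (nat (Q ℕ.* M) +_) (nat-+ ((P ℕ.+ P) ℕ.* M) (Q ℕ.* M)))) ⟩
          (nat (Q ℕ.* M) + (nat ((P ℕ.+ P) ℕ.* M) + nat (Q ℕ.* M))) * (δ * μ * ½) ≡⟨ cong₂ (λ x y → (x + (y + x)) * (δ * μ * ½)) (nat-* Q M) 2PM≡ ⟩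
          (nat Q * nat M + ((nat P + nat P) * nat M + nat Q * nat M)) * (δ * μ * ½) ≡⟨ lemma₁ (nat P) (nat Q) (nat M) δ μ ⟩
          (nat P + nat Q) * δ * (nat M * μ)                                  ≡⟨ cong₂ _*_ [P+Q]δ≡1 Mμ≡1 ⟩
          1ℚ                                                                 ∎
      ; 0<ε     = *-pos (*-pos 0<δ 0<μ) 0<½
      ; ε≤ε₀    = ≤-trans (*-mono-≤ (<⇒≤ (*-pos 0<δ 0<μ)) (<⇒≤ 0<1) (*-mono-≤ (<⇒≤ 0<δ) (<⇒≤ 0<μ) δ≤1 ≤-refl) (p≤p+d ½ (<⇒≤ 0<½)))
                    (subst (_≤ ε₀) (sym (trans (*-identityʳ (1ℚ * μ)) (*-identityˡ μ))) (<⇒≤ μ<ε₀))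
      ; outer≡  = begin
          nat (Q ℕ.* M) * (δ * μ * ½)     ≡⟨ cong (_* (δ * μ * ½)) (nat-* Q M) ⟩
          nat Q * nat M * (δ * μ * ½)     ≡⟨ lemma₂ (nat P) (nat Q) (nat M) δ μ ⟩
          ((nat P + nat Q) * δ - nat P * δ) * (nat M * μ) * ½ ≡⟨ cong₂ (λ x y → (x - nat P * δ) * y * ½) [P+Q]δ≡1 Mμ≡1 ⟩
          (1ℚ - nat P * δ) * 1ℚ * ½       ≡⟨ cong (_* ½) (trans (*-identityʳ (1ℚ - nat P * δ)) (cong (λ x → 1ℚ - x) (sym p≡))) ⟩
          (1ℚ - p) * ½                    ∎
      ; inner≡  = begin
          nat ((P ℕ.+ P) ℕ.* M) * (δ * μ * ½)   ≡⟨ cong (_* (δ * μ * ½)) 2PM≡ ⟩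
          (nat P + nat P) * nat M * (δ * μ * ½) ≡⟨ lemma₃ (nat P) (nat M) δ μ ⟩
          nat P * δ * (nat M * μ)               ≡⟨ cong₂ _*_ (sym p≡) Mμ≡1 ⟩
          p * 1ℚ                                ≡⟨ *-identityʳ p ⟩
          p                                     ∎
      }
      where
      open ≡-Reasoning
      Q : ℕ
      Q = suc d ∸ P
      0<½ : 0ℚ < ½
      0<½ = positive⁻¹ ½
      P≤D : P ℕ.≤ suc d
      P≤D = ℕ.≮⇒≥ λ D<P → <-irrefl refl (<-≤-trans
        (subst (1ℚ <_) (sym (trans (suc-mult (suc d) δ) (trans (cong (δ +_) Dδ≡1) (+-comm δ 1ℚ)))) (p<p+d 1ℚ 0<δ))
        (≤-trans (*-monoʳ-≤ (<⇒≤ 0<δ) (nat-mono D<P)) (subst (_≤ 1ℚ) p≡ p≤1)))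
      [P+Q]δ≡1 : (nat P + nat Q) * δ ≡ 1ℚ
      [P+Q]δ≡1 = trans (cong (_* δ) (trans (sym (nat-+ P Q)) (cong nat (ℕ.m+[n∸m]≡n P≤D)))) Dδ≡1
      2PM≡ : nat ((P ℕ.+ P) ℕ.* M) ≡ (nat P + nat P) * nat M
      2PM≡ = trans (nat-* (P ℕ.+ P) M) (cong (_* nat M) (nat-+ P P))
      lemma₁ : ∀ P Q M δ μ → (Q * M + ((P + P) * M + Q * M)) * (δ * μ * ½) ≡ (P + Q) * δ * (M * μ)
      lemma₁ = solve 5 (λ P Q M δ μ → (Q :* M :+ ((P :+ P) :* M :+ Q :* M)) :* (δ :* μ :* con ½) := (P :+ Q) :* δ :* (M :* μ)) refl
      lemma₂ : ∀ P Q M δ μ → Q * M * (δ * μ * ½) ≡ ((P + Q) * δ - P * δ) * (M * μ) * ½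
      lemma₂ = solve 5 (λ P Q M δ μ → Q :* M :* (δ :* μ :* con ½) := ((P :+ Q) :* δ :- P :* δ) :* (M :* μ) :* con ½) refl
      lemma₃ : ∀ P M δ μ → (P + P) * M * (δ * μ * ½) ≡ P * δ * (M * μ)
      lemma₃ = solve 4 (λ P M δ μ → (P :+ P) :* M :* (δ :* μ :* con ½) := P :* δ :* (M :* μ)) refl

  -- Used with N = |E|, h = 2^{-(n-1)}, w = (1 - p)^n, g = (1 + ε)^{n-1}.
  small-total : ∀ N x h p w g θ Q → 0ℚ < θ → θ < 1ℚ → x ≡ N * h → 0ℚ ≤ p →
    x * x * p ≤ 1ℚ - (θ + θ) → g * g * (1ℚ - θ) ≤ 1ℚ → x * w < θ →
    Q ≡ p * ((g * h) * (g * h)) →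
    N * (w * (h * ½) + (w * (h * ½) + N * Q)) < 1ℚ
  small-total N x h p w g θ Q 0<θ θ<1 x≡ 0≤p x²p≤ g²≤ xw<θ Q≡ = subst (_< 1ℚ) (sym eq)
    (subst (x * w + x * x * p * (g * g) <_) (collapse′ θ) (+-mono-<-≤ xw<θ x²pg²≤))
    where
    collapse′ : ∀ θ → θ + (1ℚ - θ) ≡ 1ℚ
    collapse′ = solve 1 (λ θ → θ :+ (con 1ℚ :- θ) := con 1ℚ) refl
    eq : N * (w * (h * ½) + (w * (h * ½) + N * Q)) ≡ x * w + x * x * p * (g * g)
    eq = trans (cong (λ Q → N * (w * (h * ½) + (w * (h * ½) + N * Q))) Q≡)
      (trans (lemma N h p w g) (cong (λ x → x * w + x * x * p * (g * g)) (sym x≡)))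
      where
      lemma : ∀ N h p w g → N * (w * (h * ½) + (w * (h * ½) + N * (p * ((g * h) * (g * h))))) ≡ N * h * w + N * h * (N * h) * p * (g * g)
      lemma = solve 5 (λ N h p w g → N :* (w :* (h :* con ½) :+ (w :* (h :* con ½) :+ N :* (p :* ((g :* h) :* (g :* h)))))
        := N :* h :* w :+ N :* h :* (N :* h) :* p :* (g :* g)) refl
    0<1-θ : 0ℚ < 1ℚ - θ
    0<1-θ = diff-pos θ<1
    x²pg²≤ : x * x * p * (g * g) ≤ 1ℚ - θ
    -- After multiplication by 1-θ the left side is at most 1-2θ, which is at most (1-θ)².
    x²pg²≤ = ≮⇒≥ λ 1-θ< → <-irrefl refl (<-≤-trans (*-monoʳ-< 0<1-θ 1-θ<) (begin
      x * x * p * (g * g) * (1ℚ - θ)   ≡⟨ *-assoc (x * x * p) (g * g) (1ℚ - θ) ⟩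
      x * x * p * (g * g * (1ℚ - θ))   ≤⟨ *-monoˡ-≤ (*-nonneg (square-nonneg x) 0≤p) g²≤ ⟩
      x * x * p * 1ℚ                   ≡⟨ *-identityʳ (x * x * p) ⟩
      x * x * p                        ≤⟨ x²p≤ ⟩
      1ℚ - (θ + θ)                     ≤⟨ le-from-diff (square-nonneg θ) (square-of θ) ⟩
      (1ℚ - θ) * (1ℚ - θ)              ∎))
      where
      open ≤-Reasoning
      square-of : ∀ θ → (1ℚ - θ) * (1ℚ - θ) ≡ 1ℚ - (θ + θ) + θ * θ
      square-of = solve 1 (λ θ → (con 1ℚ :- θ) :* (con 1ℚ :- θ) := con 1ℚ :- (θ :+ θ) :+ θ :* θ) refl

  -- The failure bound for one uniform hypergraph

  harmonic≤nat : ∀ a m → harmonic a m ≤ nat m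
  harmonic≤nat a m = subst (harmonic a m ≤_) (*-identityʳ (nat m)) (block-upper a m 0 ℕ.z≤n)

  square-cancel-< : ∀ {p q} → 0ℚ ≤ q → p * p < q * q → p < q
  square-cancel-< {p} {q} 0≤q p²<q² = ≰⇒> λ q≤p → <-irrefl refl (<-≤-trans p²<q² (*-mono-≤ 0≤q (≤-trans 0≤q q≤p) q≤p q≤p))

  -- Edges have `suc n` vertices, `T` is 2ⁿ, and `ν` is 1/(2n+2), so `l * ν` is the length of the
  -- middle part. The slack 2θ left by the crossing term is shared between the outer term and the
  -- rounding.
  module Estimate (q θ : ℚ) (0<θ : 0ℚ < θ) (θ<1 : θ < 1ℚ) (q²≡ : q * q * ½ ≡ 1ℚ - (θ + θ))
    (n : ℕ) (H : Hypergraph) (uniform : Uniform (suc n) H)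
    (T : ℚ) (T½ⁿ≡1 : T * ½ ^ n ≡ 1ℚ)
    (l : ℚ) (l≡ : l ≡ harmonic 1 n) (0<l : 0ℚ < l) (large : q * q * nat 2 < θ * θ * l)
    (E²l≤ : nat (#edges H) * nat (#edges H) * l ≤ T * T * (q * q * nat (suc n)))
    (ν : ℚ) (0<ν : 0ℚ < ν) (2nν≡1 : nat (suc n ℕ.+ suc n) * ν ≡ 1ℚ)
    where

    N h x p w : ℚ
    N = nat (#edges H)
    h = ½ ^ n
    x = N * h
    p = l * ν
    w = (1ℚ - p) ^ suc n

    0≤p : 0ℚ ≤ p
    0≤p = *-nonneg (<⇒≤ 0<l) (<⇒≤ 0<ν)

    p≤1 : p ≤ 1ℚ
    p≤1 = subst (p ≤_) 2nν≡1 (*-monoʳ-≤ (<⇒≤ 0<ν) (≤-trans (subst (_≤ nat n) (sym l≡) (harmonic≤nat 1 n))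
      (nat-mono (ℕ.m≤n⇒m≤1+n (ℕ.m≤m+n n (suc n))))))

    x²l≤ : x * x * l ≤ q * q * nat (suc n)
    x²l≤ = subst₂ _≤_ (lemma₁ N h l)
      (trans (lemma₂ T h (q * q * nat (suc n))) (trans (cong (λ y → y * y * (q * q * nat (suc n))) T½ⁿ≡1) (lemma₃ (q * q * nat (suc n)))))
      (*-monoʳ-≤ (square-nonneg h) E²l≤)
      where
      lemma₁ : ∀ N h l → N * N * l * (h * h) ≡ N * h * (N * h) * l
      lemma₁ = solve 3 (λ N h l → N :* N :* l :* (h :* h) := N :* h :* (N :* h) :* l) refl
      lemma₂ : ∀ T h b → T * T * b * (h * h) ≡ T * h * (T * h) * b
      lemma₂ = solve 3 (λ T h b → T :* T :* b :* (h :* h) := T :* h :* (T :* h) :* b) refl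
      lemma₃ : ∀ b → 1ℚ * 1ℚ * b ≡ b
      lemma₃ = solve 1 (λ b → con 1ℚ :* con 1ℚ :* b := b) refl

    x²p≤ : x * x * p ≤ 1ℚ - (θ + θ)
    x²p≤ = subst₂ _≤_ (*-assoc (x * x) l ν) eq (*-monoʳ-≤ (<⇒≤ 0<ν) x²l≤)
      where
      lemma : ∀ q s ν → q * q * s * ν ≡ q * q * ½ * ((s + s) * ν)
      lemma = solve 3 (λ q s ν → q :* q :* s :* ν := q :* q :* con ½ :* ((s :+ s) :* ν)) refl
      eq : q * q * nat (suc n) * ν ≡ 1ℚ - (θ + θ)
      eq = trans (lemma q (nat (suc n)) ν) (trans (cong (q * q * ½ *_) (trans (cong (_* ν) (sym (nat-+ (suc n) (suc n)))) 2nν≡1))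
        (trans (*-identityʳ (q * q * ½)) q²≡))

    -- The square is (1-p)^(2n+2) with p = l/(2n+2), which stands in for e^(-l). `power-harmonic`
    -- started at 1 bounds it by 2/(n+2).
    w²n≤2 : w * w * nat (suc n) ≤ nat 2
    w²n≤2 = ≤-trans (*-monoˡ-≤ (square-nonneg w) (nat-mono (ℕ.n≤1+n (suc n))))
      (subst (λ y → y * nat (suc (suc n)) ≤ nat 2) (^-homo-* (1ℚ - p) (suc n) (suc n))
        (subst (λ l → (1ℚ - l * ν) ^ (suc n ℕ.+ suc n) * nat (suc (suc n)) ≤ nat 2) (sym l≡)
          (power-harmonic (suc n ℕ.+ suc n) ν (<⇒≤ 0<ν) 2nν≡1 1 n (subst (λ l → l * ν ≤ 1ℚ) l≡ p≤1))))

    -- Squaring cancels the growth in n: (xw)² l ≤ q² (n+1) w² ≤ 2q², and `large` puts this below θ²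
    -- l.
    xw<θ : x * w < θ
    xw<θ = square-cancel-< (<⇒≤ 0<θ) (≰⇒> λ θ²≤ → <-irrefl refl (<-≤-trans large (≤-trans (*-monoʳ-≤ (<⇒≤ 0<l) θ²≤) (begin
      x * w * (x * w) * l              ≡⟨ lemma₁ x w l ⟩
      x * x * l * (w * w)              ≤⟨ *-monoʳ-≤ (square-nonneg w) x²l≤ ⟩
      q * q * nat (suc n) * (w * w)    ≡⟨ lemma₂ (q * q) (nat (suc n)) (w * w) ⟩
      q * q * (w * w * nat (suc n))    ≤⟨ *-monoˡ-≤ (square-nonneg q) w²n≤2 ⟩
      q * q * nat 2                    ∎))))
      where
      open ≤-Reasoning
      lemma₁ : ∀ x w l → x * w * (x * w) * l ≡ x * x * l * (w * w)
      lemma₁ = solve 3 (λ x w l → x :* w :* (x :* w) :* l := x :* x :* l :* (w :* w)) refl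
      lemma₂ : ∀ a s b → a * s * b ≡ a * (b * s)
      lemma₂ = solve 3 (λ a s b → a :* s :* b := a :* (b :* s)) refl

    -- Small enough for 2nε ≤ θ, which keeps the rounding factor (1+ε)²ⁿ at most 1/(1-θ); the
    -- denominator 2n+1 also serves n = 0.
    ε₀ : ℚ
    ε₀ = θ * (ℤ.+ 1 / suc (n ℕ.+ n))

    positive-probability : Grid p ε₀ → 0ℚ <Pr GreedyProper H
    positive-probability G = Discretised.small⇒positive H n uniform (outer ℕ.+ (inner ℕ.+ outer)) outer inner refl ε total≡1 0<ε
      (subst₂ (λ a b → N * (a + (a + N * b)) < 1ℚ) (sym α^≡) refl
        (small-total N x h p w g θ (nat inner * (ε * β ^ n)) 0<θ θ<1 refl 0≤p x²p≤ g²≤ xw<θ Q≡))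
      where
      open Grid G
      g β : ℚ
      g = (1ℚ + ε) ^ n
      β = (1ℚ + ε) * ½ * ((1ℚ + ε) * ½)
      α^≡ : (nat outer * ε) ^ suc n ≡ w * (h * ½)
      α^≡ = trans (cong (_^ suc n) outer≡) (trans (^-distrib-* (1ℚ - p) ½ (suc n)) (cong (w *_) (*-comm ½ h)))
      Q≡ : nat inner * (ε * β ^ n) ≡ p * ((g * h) * (g * h))
      Q≡ = trans (sym (*-assoc (nat inner) ε (β ^ n))) (cong₂ _*_ inner≡
        (trans (^-distrib-* ((1ℚ + ε) * ½) ((1ℚ + ε) * ½) n) (cong (λ y → y * y) (^-distrib-* (1ℚ + ε) ½ n))))
      -- Bernoulli at the negative argument -ε with exponent 2n.
      g²≤ : g * g * (1ℚ - θ) ≤ 1ℚ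
      g²≤ = ≤-trans (*-monoˡ-≤ (square-nonneg g) 1-θ≤)
        (subst (λ y → y * (1ℚ + nat (n ℕ.+ n) * (- ε)) ≤ 1ℚ) (trans (cong (_^ (n ℕ.+ n)) (neg-neg ε)) (^-homo-* (1ℚ + ε) n n))
          (bernoulli (- ε) (n ℕ.+ n) (≤-trans (neg-antimono-≤ (<⇒≤ 0<ε)) (<⇒≤ 0<1))))
        where
        neg-neg : ∀ ε → 1ℚ - (- ε) ≡ 1ℚ + ε
        neg-neg = solve 1 (λ ε → con 1ℚ :- (:- ε) := con 1ℚ :+ ε) refl
        m : ℚ
        m = nat (n ℕ.+ n)
        mε≤θ : m * ε ≤ θ
        mε≤θ = ≤-trans (*-mono-≤ (nat-nonneg (n ℕ.+ n)) (<⇒≤ (*-pos 0<θ (frac-pos 0 (n ℕ.+ n)))) (nat-mono (ℕ.n≤1+n (n ℕ.+ n))) ε≤ε₀)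
          (≤-reflexive (trans (lemma (nat (suc (n ℕ.+ n))) θ (ℤ.+ 1 / suc (n ℕ.+ n)))
            (trans (cong (θ *_) (unit-fraction (n ℕ.+ n))) (*-identityʳ θ))))
          where
          lemma : ∀ a b c → a * (b * c) ≡ b * (a * c)
          lemma = solve 3 (λ a b c → a :* (b :* c) := b :* (a :* c)) refl
        1-θ≤ : 1ℚ - θ ≤ 1ℚ + m * (- ε)
        1-θ≤ = le-from-diff (diff-nonneg mε≤θ) (lemma m ε θ)
          where
          lemma : ∀ m ε θ → 1ℚ + m * (- ε) ≡ 1ℚ - θ + (θ - m * ε)
          lemma = solve 3 (λ m ε θ → con 1ℚ :+ m :* (:- ε) := con 1ℚ :- θ :+ (θ :- m :* ε)) refl

    conclusion : 0ℚ <Pr GreedyProper H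
    conclusion = positive-probability (grid p ε₀ 0≤p p≤1 (*-pos 0<θ (frac-pos 0 (n ℕ.+ n))))

  -- The threshold on the uniformity

  power-of-half : ∀ n → nat (2 ℕ.^ n) * ½ ^ n ≡ 1ℚ
  power-of-half zero    = refl
  power-of-half (suc n) = trans (cong (_* (½ * ½ ^ n)) (nat-* 2 (2 ℕ.^ n))) (trans (lemma (nat (2 ℕ.^ n)) (½ ^ n)) (power-of-half n))
    where
    lemma : ∀ t h → nat 2 * t * (½ * h) ≡ t * h
    lemma = solve 2 (λ t h → con (nat 2) :* t :* (con ½ :* h) := t :* h) refl

  module Threshold (c : ℝ) (0<c : 0ᴿ <ᴿ c) (c<√2 : c <ᴿ √ (fromℕ 2)) where

    z q : ℚ
    z = proj₁ 0<c
    q = proj₁ c<√2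

    0<z : 0ℚ < z
    0<z = proj₁ (proj₂ 0<c)

    Lz : L c z
    Lz = proj₂ (proj₂ 0<c)

    Uq : U c q
    Uq = proj₁ (proj₂ c<√2)

    0<q : 0ℚ < q
    0<q = <-trans 0<z (L<U c Lz Uq)

    q²<2 : L (√ (fromℕ 2)) q → q * q < 2ℚ
    q²<2 (inj₁ q<0)  = ⊥-elim (<-asym 0<q q<0)
    q²<2 (inj₂ q²<2) = q²<2

    θ : ℚ
    θ = (1ℚ - q * q * ½) * ½

    q²≡ : q * q * ½ ≡ 1ℚ - (θ + θ)
    q²≡ = lemma (q * q)
      where
      lemma : ∀ s → s * ½ ≡ 1ℚ - ((1ℚ - s * ½) * ½ + (1ℚ - s * ½) * ½)
      lemma = solve 1 (λ s → s :* con ½ := con 1ℚ :- ((con 1ℚ :- s :* con ½) :* con ½ :+ (con 1ℚ :- s :* con ½) :* con ½)) refl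

    0<θ : 0ℚ < θ
    0<θ = *-pos (diff-pos (*-monoʳ-< {q * q} {2ℚ} {½} (positive⁻¹ ½) (q²<2 (proj₂ (proj₂ c<√2))))) (positive⁻¹ ½)

    θ<1 : θ < 1ℚ
    θ<1 = lt-from-diff {d = (1ℚ + q * q * ½) * ½} (*-pos (+-pos 0<1 (*-pos (*-pos 0<q 0<q) (positive⁻¹ ½))) (positive⁻¹ ½)) (lemma (q * q))
      where
      lemma : ∀ s → 1ℚ ≡ (1ℚ - s * ½) * ½ + (1ℚ + s * ½) * ½
      lemma = solve 1 (λ s → con 1ℚ := (con 1ℚ :- s :* con ½) :* con ½ :+ (con 1ℚ :+ s :* con ½) :* con ½) refl

    -- Both inequalities hold as soon as the harmonic sum exceeds the positive number 2q²/θ².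
    threshold : (∃ λ i → 0ℚ < i × θ * θ * i ≡ 1ℚ) →
                ∃ λ M → ∀ m → M ℕ.≤ m → 0ℚ < harmonic 1 m × q * q * nat 2 < θ * θ * harmonic 1 m
    threshold (i , 0<i , θ²i≡1) =
      let M , above = harmonic-unbounded (i * (q * q * nat 2))
      in M , λ m M≤m → <-trans (*-pos 0<i 0<2q²) (above m M≤m) ,
        subst (_< θ * θ * harmonic 1 m) (trans (sym (*-assoc (θ * θ) i (q * q * nat 2)))
          (trans (cong (_* (q * q * nat 2)) θ²i≡1) (*-identityˡ (q * q * nat 2))))
          (*-monoˡ-< (*-pos 0<θ 0<θ) (above m M≤m))
      where
      0<2q² : 0ℚ < q * q * nat 2
      0<2q² = *-pos (*-pos 0<q 0<q) (nat-positive 1)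

    bound : ∃ λ M → ∀ m → M ℕ.≤ m → 0ℚ < harmonic 1 m × q * q * nat 2 < θ * θ * harmonic 1 m
    bound = threshold (reciprocal (θ * θ) (*-pos 0<θ 0<θ))

    -- The successor appears because the harmonic sum for edges of `suc n` vertices has `n` terms.
    n₀ : ℕ
    n₀ = suc (proj₁ bound)

    -- The real inequality on the number of edges enters only through `edges-bound`; all later
    -- estimates are rational. The lower sum used for the logarithm has unit steps: 1/2 + ⋯ +
    -- 1/(n+1) for edges of `suc n` vertices.
    greedy-succeeds : ∀ n → n₀ ℕ.≤ n → (1<n : 1 ℕ.< n) → (H : Hypergraph) → Uniform n H →
      fromℕ (#edges H) ≤ᴿ c *ᴿ √ (fromℕ n *ᴿ inverse (ln n) (ln-positive 1<n)) *ᴿ fromℕ (2 ℕ.^ (n ∸ 1)) →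
      0ℚ <Pr GreedyProper H
    greedy-succeeds (suc n) (ℕ.s≤s M≤n) 1<n H uniform few = Estimate.conclusion q θ 0<θ θ<1 q²≡ n H uniform
      (nat (2 ℕ.^ n)) (power-of-half n) (lowerSum (suc n) 0) l≡ 0<l
      (subst (λ l → q * q * nat 2 < θ * θ * l) (sym l≡) (proj₂ (proj₂ bound n M≤n)))
      (edges-bound c q (suc n) (#edges H) (2 ℕ.^ n) 1<n (L-lower c 0<z Lz) (λ La → <⇒≤ (L<U c La Uq)) 0<q
        (subst (λ k → 0ℚ < nat k) (ℕ.suc-pred (2 ℕ.^ n) {{ℕ.m^n≢0 2 n}}) (nat-positive (ℕ.pred (2 ℕ.^ n)))) 0<l few)
      (ℤ.+ 1 / (suc n ℕ.+ suc n)) (frac-pos 0 (n ℕ.+ suc n)) (unit-fraction (n ℕ.+ suc n))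
      where
      l≡ : lowerSum (suc n) 0 ≡ harmonic 1 n
      l≡ = cong (harmonic 1) (ℕ.*-identityʳ n)
      0<l : 0ℚ < lowerSum (suc n) 0
      0<l = subst (0ℚ <_) (sym l≡) (proj₁ (proj₂ bound n M≤n))

open import Data.Nat.Base using (ℕ; _≤_; _<_; _^_; _∸_)
open import Data.Product using (∃; _,_)
open import Data.Rational.Base using (0ℚ)
open import Defs using (ℝ; 0ᴿ; fromℕ; _<ᴿ_; _≤ᴿ_; _*ᴿ_; inverse; √_; ln; ln-positive)
open import Defs using (Hypergraph; Uniform; GreedyProper; _<Pr_)
open Hypergraph using (#edges)

mainTheorem3 : (c : ℝ) → 0ᴿ <ᴿ c → c <ᴿ √ (fromℕ 2) →
    ∃ λ (n₀ : ℕ) → ∀ (n : ℕ) → n₀ ≤ n → (1<n : 1 < n) →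
    (H : Hypergraph) → Uniform n H →
    fromℕ (#edges H) ≤ᴿ c *ᴿ √ (fromℕ n *ᴿ inverse (ln n) (ln-positive 1<n)) *ᴿ fromℕ (2 ^ (n ∸ 1)) →
    0ℚ <Pr GreedyProper H
mainTheorem3 c 0<c c<√2 = n₀ , greedy-succeeds
  where open RandomGreedy.Threshold c 0<c c<√2
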